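{- Let $K_n$ be the complete graph on $n \geq 6$ vertices. Then $\rho'(K_n)$ is the minimum number of edges in an asymmetric graph on $n$ vertices. For $n \geq 8$ we have $$n-2-\left\lfloor \frac{n-1}{7}\right\rfloor \leq \rho'(K_n) \leq n-2.$$ Moreover, $\rho'(K_n) \sim n$, i.e. $\rho'(K_n)/n \to 1$ as $n\to\infty$.
   Context: A graph is asymmetric if its only automorphism is the identity (an asymmetric graph on $n$ vertices need not be connected; isolated vertices are allowed). An edge coloring of a graph $G$ is distinguishing if no automorphism of $G$ other than the identity preserves it. The distinguishing index $D'(G)$ is the least number $d$ such that $G$ has a distinguishing edge coloring with $d$ colors. When $D'(G)=2$ (this holds for $K_n$ with $n\ge 6$), the cost of edge-distinguishing $\rho'(G)$ is the least number of edges in the smaller of the two color classes, taken over all distinguishing edge colorings of $G$ with two colors. -}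

module Defs where

open import Level using (0ℓ)
open import Data.Bool.Base using (Bool; false; not; T)
open import Data.Bool.Properties using (T?; T-irrelevant)
open import Data.Fin.Base using (Fin; zero; suc)
open import Data.Fin.Properties using (_≟_; _<?_)
open import Data.Fin.Permutation using (Permutation′; _⟨$⟩ʳ_)
open import Data.List.Base using (length; filter; allFin; cartesianProduct)
open import Data.Nat.Base using (ℕ; _≤_; _⊓_)
open import Data.Product.Base using (Σ-syntax; ∃-syntax; _×_; _,_)
open import Relation.Binary.Core using (Rel)
open import Relation.Binary.Definitions using (Decidable)
open import Relation.Binary.PropositionalEquality
  using (_≡_; refl; sym; trans; cong)
open import Relation.Nullary.Decidable
  using (yes; no; ⌊_⌋; map′; _×-dec_)
open import Relation.Nullary.Negation using (contradiction)

IsLeast : (ℕ → Set) → ℕ → Set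
IsLeast P m = P m × (∀ k → P k → m ≤ k)

record Graph (n : ℕ) : Set where
  field
    adj        : Fin n → Fin n → Bool
    adj-sym    : ∀ i j → adj i j ≡ adj j i
    adj-irrefl : ∀ i → adj i i ≡ false

  Adj : Rel (Fin n) 0ℓ
  Adj i j = T (adj i j)

open Graph public

-- For a symmetric relation, the number of unordered pairs {i, j}, i ≠ j,
-- satisfying it: each such pair is counted once, as (i , j) with i < j.
countPairs : ∀ {n} {P : Rel (Fin n) 0ℓ} → Decidable P → ℕ
countPairs {n} P? =
  length (filter (λ (i , j) → (i <? j) ×-dec P? i j)
                 (cartesianProduct (allFin n) (allFin n)))

size : ∀ {n} → Graph n → ℕ
size G = countPairs (λ i j → T? (adj G i j))

IsAutomorphism : ∀ {n} → Graph n → Permutation′ n → Set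
IsAutomorphism G π = ∀ i j → adj G (π ⟨$⟩ʳ i) (π ⟨$⟩ʳ j) ≡ adj G i j

IsIdentity : ∀ {n} → Permutation′ n → Set
IsIdentity π = ∀ i → π ⟨$⟩ʳ i ≡ i

Asymmetric : ∀ {n} → Graph n → Set
Asymmetric G = ∀ π → IsAutomorphism G π → IsIdentity π

-- Both orientations of an edge receive the same colour, so this is a function
-- on unordered edges; the colours need not all be used.
record EdgeColouring {n} (G : Graph n) (d : ℕ) : Set where
  field
    colour     : ∀ i j → Adj G i j → Fin d
    colour-sym : ∀ i j (e : Adj G i j) (e′ : Adj G j i) →
                 colour i j e ≡ colour j i e′

open EdgeColouring public

module _ {n} {G : Graph n} where

  Preserves : ∀ {d} → Permutation′ n → EdgeColouring G d → Set
  Preserves π c =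
    ∀ i j (e : Adj G i j) (e′ : Adj G (π ⟨$⟩ʳ i) (π ⟨$⟩ʳ j)) →
    colour c (π ⟨$⟩ʳ i) (π ⟨$⟩ʳ j) e′ ≡ colour c i j e

  Distinguishing : ∀ {d} → EdgeColouring G d → Set
  Distinguishing c =
    ∀ π → IsAutomorphism G π → Preserves π c → IsIdentity π

  InClass : ∀ {d} → EdgeColouring G d → Fin d → Rel (Fin n) 0ℓ
  InClass c k i j = Σ[ e ∈ Adj G i j ] colour c i j e ≡ k

  inClass? : ∀ {d} (c : EdgeColouring G d) (k : Fin d) →
             Decidable (InClass c k)
  inClass? c k i j with T? (adj G i j)
  ... | no ¬e = no λ (e , _) → ¬e e
  ... | yes e = map′ (e ,_)
                     (λ (e′ , p) → trans (cong (colour c i j) (T-irrelevant e e′)) p)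
                     (colour c i j e ≟ k)

  classSize : ∀ {d} → EdgeColouring G d → Fin d → ℕ
  classSize c k = countPairs (inClass? c k)

IsDistinguishingIndex : ∀ {n} → Graph n → ℕ → Set
IsDistinguishingIndex G =
  IsLeast (λ d → ∃[ c ] Distinguishing {G = G} {d} c)

-- "ρ′(G) is defined and equal to r"; it is defined only when D′(G) = 2.
IsCost : ∀ {n} → Graph n → ℕ → Set
IsCost G r =
  IsDistinguishingIndex G 2 ×
  IsLeast (λ m → Σ[ c ∈ EdgeColouring G 2 ]
                   Distinguishing c ×
                   classSize c zero ⊓ classSize c (suc zero) ≡ m)
          r

IsMinAsymmetricSize : ℕ → ℕ → Set
IsMinAsymmetricSize n =
  IsLeast (λ m → Σ[ G ∈ Graph n ] Asymmetric G × size G ≡ m)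

K : ∀ n → Graph n
K n = record
  { adj        = λ i j → not ⌊ i ≟ j ⌋
  ; adj-sym    = symm
  ; adj-irrefl = irr
  }
  where
  symm : (i j : Fin n) → not ⌊ i ≟ j ⌋ ≡ not ⌊ j ≟ i ⌋
  symm i j with i ≟ j | j ≟ i
  ... | yes _ | yes _ = refl
  ... | no  _ | no  _ = refl
  ... | yes p | no ¬q = contradiction (sym p) ¬q
  ... | no ¬p | yes q = contradiction (sym q) ¬p

  irr : (i : Fin n) → not ⌊ i ≟ i ⌋ ≡ false
  irr i with i ≟ i
  ... | yes _ = refl
  ... | no ¬p = contradiction refl ¬p

{-# OPTIONS --safe #-}
module Submission where

-- A colouring of the edges of K n with two colours is distinguishing exactly
-- when each colour class is an asymmetric graph, so the cost is the minimum
-- size of an asymmetric graph. A graph on n vertices has at least n − t edges,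
-- where t is its number of tree components. In an asymmetric graph these trees
-- are asymmetric and pairwise non-isomorphic, and no tree on two to six
-- vertices is asymmetric: hence t ≤ 1 + n / 7. Likewise t ≤ N k + n / k for a
-- constant N k, the number of trees on fewer than k vertices, which gives the
-- asymptotics. An isolated vertex together with a spider with legs of lengths
-- 1, 2 and n − 5 is asymmetric and has n − 2 edges.

open import Level using (0ℓ)
open import Data.Bool.Base using (Bool; true; false; _∧_; _∨_; if_then_else_; T)
import Data.Bool.Properties as Bool
open import Data.Bool.Properties using (T?; ∨-comm)
open import Data.Empty using (⊥)
open import Data.Fin.Base using (Fin; zero; suc; toℕ; fromℕ<; inject₁; punchIn; punchOut; splitAt)
import Data.Fin.Base as Fin
open import Data.Fin.Patterns
open import Data.Fin.Permutation
  using (Permutation′; permutation; transpose; _⟨$⟩ʳ_; _⟨$⟩ˡ_; inverseˡ; inverseʳ)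
open import Data.Fin.Properties
  using (_≟_; _<?_; any?; all?; toℕ-fromℕ<; toℕ-inject₁; toℕ<n; injective⇒≤; join-splitAt;
         punchIn-injective; punchInᵢ≢i; punchIn-punchOut)
import Data.Fin.Properties as Fin
open import Data.List.Base
  using (List; []; _∷_; _++_; length; filter; allFin; upTo; tabulate;
         cartesianProduct; cartesianProductWith)
import Data.List.Base as List
open import Data.List.Properties
  using (filter-++; filter-≐; length-++; length-tabulate; map-tabulate)
open import Data.List.Membership.Propositional using (_∈_; _∉_; lose)
open import Data.List.Membership.Propositional.Properties
open import Data.List.Relation.Binary.Subset.Propositional using (_⊆_)
open import Data.List.Relation.Unary.All using (All; []; _∷_)
import Data.List.Relation.Unary.All as All
open import Data.List.Relation.Unary.All.Properties using (¬Any⇒All¬)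
open import Data.List.Relation.Unary.Any using (Any; here; there; index)
import Data.List.Relation.Unary.Any as Any
open import Data.List.Relation.Unary.Any.Properties using (lookup-index)
open import Data.List.Relation.Unary.Unique.Propositional using (Unique; []; _∷_)
import Data.List.Relation.Unary.Unique.Propositional.Properties as Unique
open import Data.Maybe.Base using (Maybe; just; nothing)
import Data.Maybe.Base as Maybe
open import Data.Nat.Base
  using (ℕ; zero; suc; NonZero; _+_; _*_; _∸_; _⊓_; _≤_; _<_; _≡ᵇ_; z≤n; s≤s; s≤s⁻¹)
open import Data.Nat.DivMod using (_%_; m≡m%n+[m/n]*n; m%n<n) renaming (_/_ to _div_)
open import Data.Nat.Properties hiding (_≟_; _<?_)
import Data.Nat.Properties as ℕ
open import Data.Nat.Solver using (module +-*-Solver)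
open import Data.Product.Base using (Σ-syntax; ∃; ∃-syntax; _×_; _,_; proj₁; proj₂)
open import Data.Sum.Base using (_⊎_; inj₁; inj₂)
import Data.Sum.Base as Sum
open import Data.Sum.Properties using (inj₁-injective; inj₂-injective)
open import Data.Vec.Base using (Vec; []; _∷_)
import Data.Vec.Base as Vec
import Data.Vec.Functional as Vector
open import Function.Base using (_∘_; id)
open import Function.Bundles using (Injection; mk⇔)
open import Function.Properties.Inverse using (↔⇒↣)
open import Relation.Binary.Core using (Rel)
open import Relation.Binary.Definitions using (Decidable; tri<; tri≈; tri>)
open import Relation.Binary.PropositionalEquality hiding (resp)
open import Relation.Nullary.Decidable
  using (Dec; yes; no; does; map′; ¬?; _×-dec_; _⊎-dec_; _→-dec_; dec-true; dec-false;
         does-⇔; decidable-stable; from-yes; True; toWitness)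
open import Relation.Nullary.Negation using (¬_; contradiction)
import Relation.Unary as Unary
open import Algebra.Properties.CommutativeMonoid.Sum +-0-commutativeMonoid
  using (sum; sum-cong-≗; ∑-distrib-+; ∑-comm; sum-remove)
open import Algebra.Properties.CommutativeSemigroup +-commutativeSemigroup using (x∙yz≈y∙xz)
open import Defs

-- Rigid structures

-- Involutions suffice for the lower bound: exchanging two equal trees is one, and a finite check
-- finds one for every tree on two to six vertices. An involution is its own inverse, so extending
-- it to the whole graph gives a permutation at once. Tree components are obtained without any
-- theory of connectivity, by recursion on the number of vertices: a vertex of degree at most one is
-- deleted, and is then put back as a new tree, as a leaf of a recorded tree, or left out. Trees
-- therefore come as codes that remember an order of attachment. A tree may have several codes,
-- which does no harm: equal codes give isomorphic trees, so the components of an asymmetric graph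
-- have distinct codes, and a bound by the number of codes still does not depend on n.
-- Constructively, a minimum requires a decidable property and a starting point. Asymmetry is
-- therefore decided by exhaustive search, and some asymmetric graph is exhibited for each n from 6
-- on. The three legs of the spider differ in length only from n = 8 on with the third the longest,
-- so 6 and 7 have a graph of their own.

-- Only involutions are excluded; b may still have automorphisms of other orders.
Rigid : {X : Set} → (X → X → Bool) → Set
Rigid {X} b = (σ : X → X) → (∀ x → σ (σ x) ≡ x) →
              (∀ x y → b (σ x) (σ y) ≡ b x y) → ∀ x → σ x ≡ x

_⊕_ : {A B : Set} → (A → A → Bool) → (B → B → Bool) → A ⊎ B → A ⊎ B → Bool
(a ⊕ b) (inj₁ x) (inj₁ y) = a x y
(a ⊕ b) (inj₁ x) (inj₂ y) = false
(a ⊕ b) (inj₂ x) (inj₁ y) = false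
(a ⊕ b) (inj₂ x) (inj₂ y) = b x y

module _ {A B : Set} {a : A → A → Bool} {b : B → B → Bool} where

  rigid-⊕ˡ : Rigid (a ⊕ b) → Rigid a
  rigid-⊕ˡ rigid σ σσ pres x = inj₁-injective (rigid σ⁺ σσ⁺ pres⁺ (inj₁ x))
    where
    σ⁺ : A ⊎ B → A ⊎ B
    σ⁺ (inj₁ x) = inj₁ (σ x)
    σ⁺ (inj₂ y) = inj₂ y
    σσ⁺ : ∀ x → σ⁺ (σ⁺ x) ≡ x
    σσ⁺ (inj₁ x) = cong inj₁ (σσ x)
    σσ⁺ (inj₂ y) = refl
    pres⁺ : ∀ x y → (a ⊕ b) (σ⁺ x) (σ⁺ y) ≡ (a ⊕ b) x y
    pres⁺ (inj₁ x) (inj₁ y) = pres x y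
    pres⁺ (inj₁ x) (inj₂ y) = refl
    pres⁺ (inj₂ x) (inj₁ y) = refl
    pres⁺ (inj₂ x) (inj₂ y) = refl

  rigid-⊕ʳ : Rigid (a ⊕ b) → Rigid b
  rigid-⊕ʳ rigid σ σσ pres y = inj₂-injective (rigid σ⁺ σσ⁺ pres⁺ (inj₂ y))
    where
    σ⁺ : A ⊎ B → A ⊎ B
    σ⁺ (inj₁ x) = inj₁ x
    σ⁺ (inj₂ y) = inj₂ (σ y)
    σσ⁺ : ∀ x → σ⁺ (σ⁺ x) ≡ x
    σσ⁺ (inj₁ x) = refl
    σσ⁺ (inj₂ y) = cong inj₂ (σσ y)
    pres⁺ : ∀ x y → (a ⊕ b) (σ⁺ x) (σ⁺ y) ≡ (a ⊕ b) x y
    pres⁺ (inj₁ x) (inj₁ y) = refl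
    pres⁺ (inj₁ x) (inj₂ y) = refl
    pres⁺ (inj₂ x) (inj₁ y) = refl
    pres⁺ (inj₂ x) (inj₂ y) = pres x y

  -- Exchanging the two copies of `a` and fixing `B` is an involution; the argument of type `A` is a
  -- point that it moves.
  ¬rigid-twins : A → ¬ Rigid (a ⊕ (a ⊕ b))
  ¬rigid-twins x rigid with rigid swap swap-swap pres (inj₁ x)
    where
    swap : A ⊎ (A ⊎ B) → A ⊎ (A ⊎ B)
    swap (inj₁ x)        = inj₂ (inj₁ x)
    swap (inj₂ (inj₁ x)) = inj₁ x
    swap (inj₂ (inj₂ y)) = inj₂ (inj₂ y)
    swap-swap : ∀ x → swap (swap x) ≡ x
    swap-swap (inj₁ x)        = refl
    swap-swap (inj₂ (inj₁ x)) = refl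
    swap-swap (inj₂ (inj₂ y)) = refl
    pres : ∀ x y → (a ⊕ (a ⊕ b)) (swap x) (swap y) ≡ (a ⊕ (a ⊕ b)) x y
    pres (inj₁ _)        (inj₁ _)        = refl
    pres (inj₁ _)        (inj₂ (inj₁ _)) = refl
    pres (inj₁ _)        (inj₂ (inj₂ _)) = refl
    pres (inj₂ (inj₁ _)) (inj₁ _)        = refl
    pres (inj₂ (inj₁ _)) (inj₂ (inj₁ _)) = refl
    pres (inj₂ (inj₁ _)) (inj₂ (inj₂ _)) = refl
    pres (inj₂ (inj₂ _)) (inj₁ _)        = refl
    pres (inj₂ (inj₂ _)) (inj₂ (inj₁ _)) = refl
    pres (inj₂ (inj₂ _)) (inj₂ (inj₂ _)) = refl
  ... | ()

-- A symmetry of `a ⊕ c` extends by the identity on `b`. Applied repeatedly, this removes whatever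
-- stands between two equal trees of a list and so brings them side by side.
rigid-⊕-drop : {A B C : Set} {a : A → A → Bool} {b : B → B → Bool}
               {c : C → C → Bool} → Rigid (a ⊕ (b ⊕ c)) → Rigid (a ⊕ c)
rigid-⊕-drop {A} {B} {C} {a} {b} {c} rigid σ σσ pres x =
  ι-injective (trans (sym (σ⁺-ι x)) (rigid σ⁺ σσ⁺ pres⁺ (ι x)))
  where
  ι : A ⊎ C → A ⊎ (B ⊎ C)
  ι (inj₁ x) = inj₁ x
  ι (inj₂ z) = inj₂ (inj₂ z)
  ι-injective : ∀ {x y} → ι x ≡ ι y → x ≡ y
  ι-injective {inj₁ _} {inj₁ _} refl = refl
  ι-injective {inj₂ _} {inj₂ _} refl = refl
  σ⁺ : A ⊎ (B ⊎ C) → A ⊎ (B ⊎ C)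
  σ⁺ (inj₁ x)        = ι (σ (inj₁ x))
  σ⁺ (inj₂ (inj₁ y)) = inj₂ (inj₁ y)
  σ⁺ (inj₂ (inj₂ z)) = ι (σ (inj₂ z))
  σ⁺-ι : ∀ x → σ⁺ (ι x) ≡ ι (σ x)
  σ⁺-ι (inj₁ x) = refl
  σ⁺-ι (inj₂ z) = refl
  σσ⁺ : ∀ x → σ⁺ (σ⁺ x) ≡ x
  σσ⁺ (inj₁ x)        = trans (σ⁺-ι (σ (inj₁ x))) (cong ι (σσ (inj₁ x)))
  σσ⁺ (inj₂ (inj₁ y)) = refl
  σσ⁺ (inj₂ (inj₂ z)) = trans (σ⁺-ι (σ (inj₂ z))) (cong ι (σσ (inj₂ z)))
  adj⁺ = a ⊕ (b ⊕ c)
  ι-adj : ∀ x y → adj⁺ (ι x) (ι y) ≡ (a ⊕ c) x y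
  ι-adj (inj₁ _) (inj₁ _) = refl
  ι-adj (inj₁ _) (inj₂ _) = refl
  ι-adj (inj₂ _) (inj₁ _) = refl
  ι-adj (inj₂ _) (inj₂ _) = refl
  ι-adjˡ : ∀ y x → adj⁺ (inj₂ (inj₁ y)) (ι x) ≡ false
  ι-adjˡ y (inj₁ _) = refl
  ι-adjˡ y (inj₂ _) = refl
  ι-adjʳ : ∀ x y → adj⁺ (ι x) (inj₂ (inj₁ y)) ≡ false
  ι-adjʳ (inj₁ _) y = refl
  ι-adjʳ (inj₂ _) y = refl
  ισ-adj : ∀ x y → adj⁺ (ι (σ x)) (ι (σ y)) ≡ (a ⊕ c) x y
  ισ-adj x y = trans (ι-adj (σ x) (σ y)) (pres x y)
  pres⁺ : ∀ x y → adj⁺ (σ⁺ x) (σ⁺ y) ≡ adj⁺ x y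
  pres⁺ (inj₁ x)        (inj₁ y)        = ισ-adj (inj₁ x) (inj₁ y)
  pres⁺ (inj₁ x)        (inj₂ (inj₁ y)) = ι-adjʳ (σ (inj₁ x)) y
  pres⁺ (inj₁ x)        (inj₂ (inj₂ y)) = ισ-adj (inj₁ x) (inj₂ y)
  pres⁺ (inj₂ (inj₁ x)) (inj₁ y)        = ι-adjˡ x (σ (inj₁ y))
  pres⁺ (inj₂ (inj₁ x)) (inj₂ (inj₁ y)) = refl
  pres⁺ (inj₂ (inj₁ x)) (inj₂ (inj₂ y)) = ι-adjˡ x (σ (inj₂ y))
  pres⁺ (inj₂ (inj₂ x)) (inj₁ y)        = ισ-adj (inj₂ x) (inj₁ y)
  pres⁺ (inj₂ (inj₂ x)) (inj₂ (inj₁ y)) = ι-adjʳ (σ (inj₂ x)) y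
  pres⁺ (inj₂ (inj₂ x)) (inj₂ (inj₂ y)) = ισ-adj (inj₂ x) (inj₂ y)

-- Codes of trees and forests

-- A code with index c describes a tree on c + 1 vertices, grown leaf by leaf:
-- cd ▹ p attaches a new vertex, which becomes vertex 0, to the vertex p of cd.
data Code : ℕ → Set where
  root : Code 0
  _▹_  : ∀ {c} → Code c → Fin (suc c) → Code (suc c)

codeAdj : ∀ {c} → Code c → Fin (suc c) → Fin (suc c) → Bool
codeAdj root     _       _       = false
codeAdj (cd ▹ p) zero    zero    = false
codeAdj (cd ▹ p) zero    (suc j) = does (j ≟ p)
codeAdj (cd ▹ p) (suc i) zero    = does (i ≟ p)
codeAdj (cd ▹ p) (suc i) (suc j) = codeAdj cd i j

Tree : Set
Tree = ∃ Code

Forest : Set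
Forest = List Tree

Pos : Forest → Set
Pos []            = ⊥
Pos ((c , _) ∷ F) = Fin (suc c) ⊎ Pos F

forestAdj : ∀ F → Pos F → Pos F → Bool
forestAdj ((_ , cd) ∷ F) = codeAdj cd ⊕ forestAdj F

rigid⇒∉ : ∀ C F → Rigid (forestAdj (C ∷ F)) → C ∉ F
rigid⇒∉ C (_ ∷ F) rigid (here refl) = ¬rigid-twins zero rigid
rigid⇒∉ C (D ∷ F) rigid (there C∈F) =
  rigid⇒∉ C F (rigid-⊕-drop rigid) C∈F

-- Distinctness here is that of codes: isomorphic trees with different codes are not compared. This
-- matches the later bounds, which count codes.
rigid⇒unique : ∀ F → Rigid (forestAdj F) → Unique F
rigid⇒unique []      rigid = []
rigid⇒unique (C ∷ F) rigid =
  ¬Any⇒All¬ F (rigid⇒∉ C F rigid) ∷ rigid⇒unique F (rigid-⊕ʳ rigid)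

rigid⇒all : ∀ F → Rigid (forestAdj F) → All (λ (_ , cd) → Rigid (codeAdj cd)) F
rigid⇒all []      rigid = []
rigid⇒all (C ∷ F) rigid = rigid-⊕ˡ rigid ∷ rigid⇒all F (rigid-⊕ʳ rigid)

-- Small trees

Symmetry : ∀ {c} → Code c → Vec (Fin (suc c)) (suc c) → Set
Symmetry cd v =
  (∃[ i ] Vec.lookup v i ≢ i) ×
  (∀ i → Vec.lookup v (Vec.lookup v i) ≡ i) ×
  (∀ i j → codeAdj cd (Vec.lookup v i) (Vec.lookup v j) ≡ codeAdj cd i j)

symmetry? : ∀ {c} (cd : Code c) v → Dec (Symmetry cd v)
symmetry? cd v =
  any? (λ i → ¬? (Vec.lookup v i ≟ i)) ×-dec
  all? (λ i → Vec.lookup v (Vec.lookup v i) ≟ i) ×-dec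
  all? (λ i → all? (λ j →
    codeAdj cd (Vec.lookup v i) (Vec.lookup v j) Bool.≟ codeAdj cd i j))

-- The two parts of the list are the involutions that move 0 and those that fix it. The list merely
-- supplies candidates, each of which `Symmetry` checks in full.
involutions : ∀ n → List (Vec (Fin n) n)
involutions 0             = [] ∷ []
involutions 1             = (zero ∷ []) ∷ []
involutions (suc (suc n)) =
  List.concatMap (λ j → List.map (pair-with j) (involutions n)) (allFin (suc n)) ++
  List.map (λ v → zero ∷ Vec.map suc v) (involutions (suc n))
  where
  pair-with : Fin (suc n) → Vec (Fin n) n → Vec (Fin (2 + n)) (2 + n)
  pair-with j v = suc j ∷ Vec.tabulate image
    where
    image : Fin (suc n) → Fin (2 + n)
    image i with j ≟ i
    ... | yes _  = zero
    -- Apart from 0 and `suc j`, the points are relabelled by skipping `j`, permuted by `v`, and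
    -- relabelled back.
    ... | no j≢i = suc (punchIn j (Vec.lookup v (punchOut j≢i)))

all-codes? : ∀ {c} {P : Code c → Set} → (∀ cd → Dec (P cd)) → Dec (∀ cd → P cd)
all-codes? {zero} P? = map′ (λ { p root → p }) (λ f → f root) (P? root)
all-codes? {suc c} P? =
  map′ (λ { f (cd ▹ p) → f cd p }) (λ f cd p → f (cd ▹ p))
       (all-codes? λ cd → all? λ p → P? (cd ▹ p))

has-symmetry? : ∀ c → Dec (∀ (cd : Code c) → Any (Symmetry cd) (involutions (suc c)))
has-symmetry? c = all-codes? λ cd → Any.any? (symmetry? cd) (involutions (suc c))

flexible : ∀ {c} → (∀ (cd : Code c) → Any (Symmetry cd) (involutions (suc c))) →
           (cd : Code c) → ¬ Rigid (codeAdj cd)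
flexible sym cd rigid with Any.satisfied (sym cd)
... | v , (i , vi≢i) , inv , pres = vi≢i (rigid (Vec.lookup v) inv pres i)

-- Index `c` means `c + 1` vertices. The cases 1 to 5 are settled by evaluation: there are c! codes
-- of index `c`, so at most 120 codes are tried against at most 76 involutions.
rigid-small : ∀ {c} (cd : Code c) → Rigid (codeAdj cd) → c ≡ 0 ⊎ 6 ≤ c
rigid-small {0} cd rigid = inj₁ refl
rigid-small {1} cd rigid = contradiction rigid (flexible (from-yes (has-symmetry? 1)) cd)
rigid-small {2} cd rigid = contradiction rigid (flexible (from-yes (has-symmetry? 2)) cd)
rigid-small {3} cd rigid = contradiction rigid (flexible (from-yes (has-symmetry? 3)) cd)
rigid-small {4} cd rigid = contradiction rigid (flexible (from-yes (has-symmetry? 4)) cd)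
rigid-small {5} cd rigid = contradiction rigid (flexible (from-yes (has-symmetry? 5)) cd)
rigid-small {suc (suc (suc (suc (suc (suc c)))))} cd rigid =
  inj₂ (s≤s (s≤s (s≤s (s≤s (s≤s (s≤s z≤n))))))

-- Tree components of a graph

-- `exact` makes the image an induced copy of the forest, and `closed` makes it a union of
-- components of `G`.
record Embedding {n} (G : Graph n) (F : Forest) : Set where
  field
    vertex    : Pos F → Fin n
    injective : ∀ {p q} → vertex p ≡ vertex q → p ≡ q
    exact     : ∀ p q → adj G (vertex p) (vertex q) ≡ forestAdj F p q
    closed    : ∀ p v → adj G (vertex p) v ≡ true → ∃[ q ] vertex q ≡ v

anyPos? : ∀ F {P : Pos F → Set} → (∀ p → Dec (P p)) → Dec (∃ P)
anyPos? []      P? = no λ ()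
anyPos? (C ∷ F) P? =
  map′ (λ { (inj₁ (i , p)) → inj₁ i , p ; (inj₂ (q , p)) → inj₂ q , p })
       (λ { (inj₁ i , p) → inj₁ (i , p) ; (inj₂ q , p) → inj₂ (q , p) })
       (any? (λ i → P? (inj₁ i)) ⊎-dec anyPos? F (λ q → P? (inj₂ q)))

-- Since no edge leaves the image, a symmetry of the forest extended by the identity outside the
-- image is an automorphism of `G`.
asymmetric⇒rigid : ∀ {n} {G : Graph n} {F} → Asymmetric G → Embedding G F →
                   Rigid (forestAdj F)
asymmetric⇒rigid {n} {G} {F} asym E σ σσ pres p =
  injective (trans (sym (π-vertex p)) (asym π⁺ π-adj (vertex p)))
  where
  open Embedding E

  position? : ∀ v → Dec (∃[ q ] vertex q ≡ v)
  position? v = anyPos? F (λ q → vertex q ≟ v)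

  π : Fin n → Fin n
  π v with position? v
  ... | yes (q , _) = vertex (σ q)
  ... | no _        = v

  π-vertex : ∀ q → π (vertex q) ≡ vertex (σ q)
  π-vertex q with position? (vertex q)
  ... | yes (q′ , eq) = cong (vertex ∘ σ) (injective eq)
  ... | no ¬q         = contradiction (q , refl) ¬q

  π-other : ∀ v → ¬ (∃[ q ] vertex q ≡ v) → π v ≡ v
  π-other v ¬q with position? v
  ... | yes q = contradiction q ¬q
  ... | no _  = refl

  ππ : ∀ v → π (π v) ≡ v
  ππ v with position? v
  ... | yes (q , refl) = trans (π-vertex (σ q)) (cong vertex (σσ q))
  ... | no ¬q          = π-other v ¬q

  π⁺ : Permutation′ n
  π⁺ = permutation π π ππ ππ

  nonadjacent : ∀ p v → ¬ (∃[ q ] vertex q ≡ v) → adj G (vertex p) v ≡ false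
  nonadjacent p v ¬q with adj G (vertex p) v in eq
  ... | true  = contradiction (closed p v eq) ¬q
  ... | false = refl

  π-adj : ∀ u v → adj G (π u) (π v) ≡ adj G u v
  π-adj u v with position? u | position? v
  ... | yes (p , refl) | yes (q , refl) =
    trans (exact (σ p) (σ q)) (trans (pres p q) (sym (exact p q)))
  ... | yes (p , refl) | no ¬v =
    trans (nonadjacent (σ p) v ¬v) (sym (nonadjacent p v ¬v))
  ... | no ¬u | yes (q , refl) =
    trans (adj-sym G u _) (trans (nonadjacent (σ q) u ¬u)
      (sym (trans (adj-sym G u _) (nonadjacent q u ¬u))))
  ... | no _ | no _ = refl

-- Adding a vertex to a forest

extendAdj : {A : Set} → (A → A → Bool) → (A → Bool) → Maybe A → Maybe A → Bool
extendAdj b nb nothing  nothing  = false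
extendAdj b nb nothing  (just y) = nb y
extendAdj b nb (just x) nothing  = nb x
extendAdj b nb (just x) (just y) = b x y

-- `Maybe (Pos F)` stands for `F` with a new vertex `nothing` whose neighbours are given by `nb`.
-- The bijection with `Pos F⁺` is an injective `shrink` with a section `grow`: embeddings are
-- composed with `shrink`, and `grow` finds the positions required by `closed`.
record Growth (F F⁺ : Forest) (nb : Pos F → Bool) : Set where
  field
    shrink           : Pos F⁺ → Maybe (Pos F)
    shrink-injective : ∀ {p q} → shrink p ≡ shrink q → p ≡ q
    grow             : Maybe (Pos F) → Pos F⁺
    shrink-grow      : ∀ m → shrink (grow m) ≡ m
    adj-shrink       : ∀ p q → forestAdj F⁺ p q ≡
                       extendAdj (forestAdj F) nb (shrink p) (shrink q)

open Growth

sprout : ∀ F → Growth F ((0 , root) ∷ F) (λ _ → false)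
sprout F .shrink (inj₁ zero) = nothing
sprout F .shrink (inj₂ q)    = just q
sprout F .shrink-injective {inj₁ zero} {inj₁ zero} _ = refl
sprout F .shrink-injective {inj₂ _}    {inj₂ _}    refl = refl
sprout F .shrink-injective {inj₂ _}    {inj₁ zero} ()
sprout F .grow nothing  = inj₁ zero
sprout F .grow (just q) = inj₂ q
sprout F .shrink-grow nothing  = refl
sprout F .shrink-grow (just q) = refl
sprout F .adj-shrink (inj₁ zero) (inj₁ zero) = refl
sprout F .adj-shrink (inj₁ zero) (inj₂ _)    = refl
sprout F .adj-shrink (inj₂ _)    (inj₁ zero) = refl
sprout F .adj-shrink (inj₂ _)    (inj₂ _)    = refl

samePos : ∀ F → Pos F → Pos F → Bool
samePos (_ ∷ F) (inj₁ i) (inj₁ j) = does (i ≟ j)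
samePos (_ ∷ F) (inj₁ _) (inj₂ _) = false
samePos (_ ∷ F) (inj₂ _) (inj₁ _) = false
samePos (_ ∷ F) (inj₂ p) (inj₂ q) = samePos F p q

samePos-refl : ∀ F p → samePos F p p ≡ true
samePos-refl (_ ∷ F) (inj₁ i) = dec-true (i ≟ i) refl
samePos-refl (_ ∷ F) (inj₂ p) = samePos-refl F p

samePos⇒≡ : ∀ F p q → samePos F p q ≡ true → p ≡ q
samePos⇒≡ (_ ∷ F) (inj₁ i) (inj₁ j) eq with i ≟ j
... | yes i≡j = cong inj₁ i≡j
samePos⇒≡ (_ ∷ F) (inj₂ p) (inj₂ q) eq = cong inj₂ (samePos⇒≡ F p q eq)

graft : ∀ F → Pos F → Forest
graft ((c , cd) ∷ F) (inj₁ p) = (suc c , cd ▹ p) ∷ F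
graft (C ∷ F)        (inj₂ p) = C ∷ graft F p

length-graft : ∀ F p → length (graft F p) ≡ length F
length-graft (_ ∷ F) (inj₁ p) = refl
length-graft (_ ∷ F) (inj₂ p) = cong suc (length-graft F p)

graft-growth : ∀ F p → Growth F (graft F p) (λ q → samePos F q p)
graft-growth (C ∷ F) (inj₁ p) .shrink (inj₁ zero)    = nothing
graft-growth (C ∷ F) (inj₁ p) .shrink (inj₁ (suc i)) = just (inj₁ i)
graft-growth (C ∷ F) (inj₁ p) .shrink (inj₂ q)       = just (inj₂ q)
graft-growth (C ∷ F) (inj₁ p) .shrink-injective {inj₁ zero}    {inj₁ zero}    _    = refl
graft-growth (C ∷ F) (inj₁ p) .shrink-injective {inj₁ (suc _)} {inj₁ (suc _)} refl = refl
graft-growth (C ∷ F) (inj₁ p) .shrink-injective {inj₂ _}       {inj₂ _}       refl = refl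
graft-growth (C ∷ F) (inj₁ p) .shrink-injective {inj₂ _}       {inj₁ zero}    ()
graft-growth (C ∷ F) (inj₁ p) .shrink-injective {inj₂ _}       {inj₁ (suc _)} ()
graft-growth (C ∷ F) (inj₁ p) .grow nothing         = inj₁ zero
graft-growth (C ∷ F) (inj₁ p) .grow (just (inj₁ i)) = inj₁ (suc i)
graft-growth (C ∷ F) (inj₁ p) .grow (just (inj₂ q)) = inj₂ q
graft-growth (C ∷ F) (inj₁ p) .shrink-grow nothing         = refl
graft-growth (C ∷ F) (inj₁ p) .shrink-grow (just (inj₁ i)) = refl
graft-growth (C ∷ F) (inj₁ p) .shrink-grow (just (inj₂ q)) = refl
graft-growth (C ∷ F) (inj₁ p) .adj-shrink (inj₁ zero)    (inj₁ zero)    = refl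
graft-growth (C ∷ F) (inj₁ p) .adj-shrink (inj₁ zero)    (inj₁ (suc _)) = refl
graft-growth (C ∷ F) (inj₁ p) .adj-shrink (inj₁ zero)    (inj₂ _)       = refl
graft-growth (C ∷ F) (inj₁ p) .adj-shrink (inj₁ (suc _)) (inj₁ zero)    = refl
graft-growth (C ∷ F) (inj₁ p) .adj-shrink (inj₁ (suc _)) (inj₁ (suc _)) = refl
graft-growth (C ∷ F) (inj₁ p) .adj-shrink (inj₁ (suc _)) (inj₂ _)       = refl
graft-growth (C ∷ F) (inj₁ p) .adj-shrink (inj₂ _)       (inj₁ zero)    = refl
graft-growth (C ∷ F) (inj₁ p) .adj-shrink (inj₂ _)       (inj₁ (suc _)) = refl
graft-growth (C ∷ F) (inj₁ p) .adj-shrink (inj₂ _)       (inj₂ _)       = refl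
graft-growth (C ∷ F) (inj₂ p) = record
  { shrink           = shrink⁺
  ; shrink-injective = λ {p} {q} → injective⁺ p q
  ; grow             = grow⁺
  ; shrink-grow      = shrink-grow⁺
  ; adj-shrink       = adj⁺
  }
  where
  module γ = Growth (graft-growth F p)

  shrink⁺ : Pos (C ∷ graft F p) → Maybe (Pos (C ∷ F))
  shrink⁺ (inj₁ i) = just (inj₁ i)
  shrink⁺ (inj₂ q) = Maybe.map inj₂ (γ.shrink q)

  injective⁺ : ∀ p q → shrink⁺ p ≡ shrink⁺ q → p ≡ q
  injective⁺ (inj₁ _) (inj₁ _) refl = refl
  injective⁺ (inj₁ _) (inj₂ q) eq with γ.shrink q
  injective⁺ (inj₁ _) (inj₂ q) () | nothing
  injective⁺ (inj₁ _) (inj₂ q) () | just _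
  injective⁺ (inj₂ p) (inj₁ _) eq with γ.shrink p
  injective⁺ (inj₂ p) (inj₁ _) () | nothing
  injective⁺ (inj₂ p) (inj₁ _) () | just _
  injective⁺ (inj₂ p) (inj₂ q) eq = cong inj₂ (γ.shrink-injective (peel _ _ eq))
    where
    peel : ∀ m m′ → Maybe.map inj₂ m ≡ Maybe.map {B = Pos (C ∷ F)} inj₂ m′ → m ≡ m′
    peel nothing  nothing  _    = refl
    peel (just _) (just _) refl = refl

  grow⁺ : Maybe (Pos (C ∷ F)) → Pos (C ∷ graft F p)
  grow⁺ nothing         = inj₂ (γ.grow nothing)
  grow⁺ (just (inj₁ i)) = inj₁ i
  grow⁺ (just (inj₂ q)) = inj₂ (γ.grow (just q))

  shrink-grow⁺ : ∀ m → shrink⁺ (grow⁺ m) ≡ m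
  shrink-grow⁺ nothing         = cong (Maybe.map inj₂) (γ.shrink-grow nothing)
  shrink-grow⁺ (just (inj₁ i)) = refl
  shrink-grow⁺ (just (inj₂ q)) = cong (Maybe.map inj₂) (γ.shrink-grow (just q))

  adj⁺ : ∀ q r → forestAdj (C ∷ graft F p) q r ≡
         extendAdj (forestAdj (C ∷ F)) (λ q → samePos (C ∷ F) q (inj₂ p)) (shrink⁺ q) (shrink⁺ r)
  adj⁺ (inj₁ _) (inj₁ _) = refl
  adj⁺ (inj₁ _) (inj₂ r) with γ.shrink r
  ... | nothing = refl
  ... | just _  = refl
  adj⁺ (inj₂ q) (inj₁ _) with γ.shrink q
  ... | nothing = refl
  ... | just _  = refl
  adj⁺ (inj₂ q) (inj₂ r) = trans (γ.adj-shrink q r) (lift (γ.shrink q) (γ.shrink r))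
    where
    lift : ∀ m m′ →
           extendAdj (forestAdj F) (λ q → samePos F q p) m m′ ≡
           extendAdj (forestAdj (C ∷ F)) (λ q → samePos (C ∷ F) q (inj₂ p))
                     (Maybe.map inj₂ m) (Maybe.map inj₂ m′)
    lift nothing  nothing  = refl
    lift nothing  (just _) = refl
    lift (just _) nothing  = refl
    lift (just _) (just _) = refl

-- Deleting a vertex from a graph

delete : ∀ {n} → Graph (suc n) → Fin (suc n) → Graph n
delete G v = record
  { adj        = λ i j → adj G (punchIn v i) (punchIn v j)
  ; adj-sym    = λ i j → adj-sym G _ _
  ; adj-irrefl = λ i → adj-irrefl G _
  }

data PunchView {n} (v : Fin (suc n)) : Fin (suc n) → Set where
  hole  : PunchView v v
  other : ∀ j → PunchView v (punchIn v j)

punchView : ∀ {n} (v w : Fin (suc n)) → PunchView v w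
punchView v w with v ≟ w
... | yes refl = hole
... | no v≢w   = subst (PunchView v) (punchIn-punchOut v≢w) (other (punchOut v≢w))

module _ {n} {G : Graph (suc n)} {v : Fin (suc n)} {F} (E : Embedding (delete G v) F) where
  open Embedding E

  -- As `v` has no neighbour in the forest, putting it back leaves the trees full components.
  embedding-keep : (∀ q → adj G v (punchIn v (vertex q)) ≡ false) → Embedding G F
  embedding-keep v∉nbrs = record
    { vertex    = punchIn v ∘ vertex
    ; injective = λ eq → injective (punchIn-injective v _ _ eq)
    ; exact     = exact
    ; closed    = closed⁺
    }
    where
    closed⁺ : ∀ p w → adj G (punchIn v (vertex p)) w ≡ true →
              ∃[ q ] punchIn v (vertex q) ≡ w
    closed⁺ p w eq with punchView v w
    ... | hole with () ← trans (sym eq) (trans (adj-sym G _ v) (v∉nbrs p))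
    ... | other j with q , refl ← closed p j eq = q , refl

  -- The last hypothesis puts every neighbour of `v` in the forest, so the enlarged forest is again
  -- a union of components.
  embedding-grow : ∀ {F⁺ nb} → Growth F F⁺ nb →
                   (∀ q → adj G v (punchIn v (vertex q)) ≡ nb q) →
                   (∀ w → adj G v w ≡ true → ∃[ q ] punchIn v (vertex q) ≡ w) →
                   Embedding G F⁺
  embedding-grow {F⁺} {nb} γ v-adj v-closed = record
    { vertex    = place ∘ shrink γ
    ; injective = λ eq → shrink-injective γ (place-injective _ _ eq)
    ; exact     = λ p q → trans (place-adj (shrink γ p) (shrink γ q)) (sym (adj-shrink γ p q))
    ; closed    = λ p w eq → re-index (place-closed (shrink γ p) w eq)
    }
    where
    place : Maybe (Pos F) → Fin (suc n)
    place nothing  = v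
    place (just q) = punchIn v (vertex q)

    place-injective : ∀ m m′ → place m ≡ place m′ → m ≡ m′
    place-injective nothing  nothing  _  = refl
    place-injective nothing  (just q) eq = contradiction (sym eq) (punchInᵢ≢i v _)
    place-injective (just p) nothing  eq = contradiction eq (punchInᵢ≢i v _)
    place-injective (just p) (just q) eq = cong just (injective (punchIn-injective v _ _ eq))

    place-adj : ∀ m m′ → adj G (place m) (place m′) ≡ extendAdj (forestAdj F) nb m m′
    place-adj nothing  nothing  = adj-irrefl G v
    place-adj nothing  (just q) = v-adj q
    place-adj (just p) nothing  = trans (adj-sym G _ v) (v-adj p)
    place-adj (just p) (just q) = exact p q

    place-closed : ∀ m w → adj G (place m) w ≡ true → ∃[ m′ ] place m′ ≡ w
    place-closed nothing  w eq with q , q≡ ← v-closed w eq = just q , q≡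
    place-closed (just p) w eq with punchView v w
    ... | hole    = nothing , refl
    ... | other j with q , refl ← closed p j eq = just q , refl

    re-index : ∀ {w} → (∃[ m ] place m ≡ w) → ∃[ q ] place (shrink γ q) ≡ w
    re-index (m , eq) = grow γ m , trans (cong place (shrink-grow γ m)) eq

-- Degrees

ind : Bool → ℕ
ind true  = 1
ind false = 0

count : ∀ {n} → (Fin n → Bool) → ℕ
count b = sum (ind ∘ b)

data Counted {n} (b : Fin n → Bool) : Set where
  noTrue : (∀ i → b i ≡ false) → count b ≡ 0 → Counted b
  oneTrue : ∀ u → b u ≡ true → (∀ i → b i ≡ true → i ≡ u) → count b ≡ 1 → Counted b
  manyTrue : 2 ≤ count b → Counted b

counted : ∀ {n} (b : Fin n → Bool) → Counted b
counted {zero}  b = noTrue (λ ()) refl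
counted {suc n} b with b zero in b₀ | counted (b ∘ suc)
... | false | noTrue all c = noTrue (λ { zero → b₀ ; (suc i) → all i }) (cong₂ _+_ (cong ind b₀) c)
... | true  | noTrue all c = oneTrue zero b₀
        (λ { zero _ → refl ; (suc i) bi → contradiction (trans (sym bi) (all i)) λ () })
        (cong₂ _+_ (cong ind b₀) c)
... | false | oneTrue u bu uniq c = oneTrue (suc u) bu
        (λ { zero b₀′ → contradiction (trans (sym b₀′) b₀) λ () ; (suc i) bi → cong suc (uniq i bi) })
        (cong₂ _+_ (cong ind b₀) c)
... | true  | oneTrue u bu uniq c = manyTrue (≤-reflexive (sym (cong₂ _+_ (cong ind b₀) c)))
... | _     | manyTrue c          = manyTrue (≤-trans c (m≤n+m _ _))

degree : ∀ {n} → Graph n → Fin n → ℕ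
degree G v = count (adj G v)

degreeSum : ∀ {n} → Graph n → ℕ
degreeSum G = sum (degree G)

degree-delete : ∀ {n} (G : Graph (suc n)) v → degree G v ≡ count (λ i → adj G v (punchIn v i))
degree-delete G v = trans (sum-remove {i = v} (λ i → ind (adj G v i)))
  (cong (λ b → ind b + count (λ i → adj G v (punchIn v i))) (adj-irrefl G v))

-- Deleting `v` loses its own degree and one from the degree of each neighbour.
degreeSum-delete : ∀ {n} (G : Graph (suc n)) v →
                   degreeSum G ≡ 2 * degree G v + degreeSum (delete G v)
degreeSum-delete G v = begin
  sum (degree G)
    ≡⟨ sum-remove {i = v} (degree G) ⟩
  degree G v + sum (λ i → degree G (punchIn v i))
    ≡⟨ cong (degree G v +_) (sum-cong-≗ λ i → sum-remove {i = v} (λ j → ind (adj G (punchIn v i) j))) ⟩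
  degree G v + sum (λ i → ind (adj G (punchIn v i) v) + degree (delete G v) i)
    ≡⟨ cong (degree G v +_) (∑-distrib-+ (λ i → ind (adj G (punchIn v i) v)) _) ⟩
  degree G v + (count (λ i → adj G (punchIn v i) v) + degreeSum (delete G v))
    ≡⟨ cong (λ d → degree G v + (d + degreeSum (delete G v)))
         (trans (sum-cong-≗ λ i → cong ind (adj-sym G (punchIn v i) v)) (sym (degree-delete G v))) ⟩
  degree G v + (degree G v + degreeSum (delete G v))
    ≡⟨ +-assoc (degree G v) _ _ ⟨
  degree G v + degree G v + degreeSum (delete G v)
    ≡⟨ cong (λ d → degree G v + d + degreeSum (delete G v)) (+-identityʳ (degree G v)) ⟨
  2 * degree G v + degreeSum (delete G v) ∎
  where open ≡-Reasoning

sum-≥ : ∀ {n} k (f : Fin n → ℕ) → (∀ i → k ≤ f i) → k * n ≤ sum f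
sum-≥ {zero}  k f k≤f = ≤-reflexive (*-zeroʳ k)
sum-≥ {suc n} k f k≤f = ≤-trans (≤-reflexive (*-suc k n))
  (+-mono-≤ (k≤f zero) (sum-≥ k (f ∘ suc) (k≤f ∘ suc)))

-- Peeling off vertices of degree at most one leaves a graph of minimum degree
-- two, which has at least as many edges as vertices; each edge lost on the way
-- is paid for by a vertex, except for one vertex in each tree component.
treeComponents : ∀ {n} (G : Graph n) →
  ∃[ F ] Embedding G F × 2 * n ≤ degreeSum G + 2 * length F
treeComponents {zero} G =
  [] , record { vertex = λ () ; injective = λ { {()} } ; exact = λ () ; closed = λ () } , z≤n
treeComponents {suc n} G with any? (λ v → ¬? (2 ≤? degree G v))
... | no all≥2 =
  [] , record { vertex = λ () ; injective = λ { {()} } ; exact = λ () ; closed = λ () } ,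
  ≤-trans (sum-≥ 2 (degree G) deg≥2) (m≤m+n _ _)
  where
  deg≥2 : ∀ v → 2 ≤ degree G v
  deg≥2 v with 2 ≤? degree G v
  ... | yes p = p
  ... | no ¬p = contradiction (v , ¬p) all≥2
... | yes (v , small) with treeComponents (delete G v) | counted (adj G v)
...   | F , E , bound | manyTrue 2≤ = contradiction 2≤ small
...   | F , E , bound | noTrue isolated deg≡0 =
  (0 , root) ∷ F ,
  embedding-grow E (sprout F) (λ q → isolated _)
    (λ w eq → contradiction (trans (sym eq) (isolated w)) λ ()) ,
  (begin
    2 * suc n                                     ≡⟨ *-suc 2 n ⟩
    2 + 2 * n                                     ≤⟨ +-monoʳ-≤ 2 bound ⟩
    2 + (degreeSum (delete G v) + 2 * length F)   ≡⟨ +-assoc 2 (degreeSum (delete G v)) _ ⟨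
    2 + degreeSum (delete G v) + 2 * length F     ≡⟨ cong (_+ 2 * length F) (+-comm 2 (degreeSum (delete G v))) ⟩
    degreeSum (delete G v) + 2 + 2 * length F     ≡⟨ +-assoc (degreeSum (delete G v)) 2 _ ⟩
    degreeSum (delete G v) + (2 + 2 * length F)   ≡⟨ cong₂ _+_ same (sym (*-suc 2 (length F))) ⟩
    degreeSum G + 2 * suc (length F)              ∎)
  where
  open ≤-Reasoning
  same : degreeSum (delete G v) ≡ degreeSum G
  same = sym (trans (degreeSum-delete G v) (cong (λ d → 2 * d + degreeSum (delete G v)) deg≡0))
...   | F , E , bound | oneTrue u v~u unique deg≡1 = result
  where
  open Embedding E
  open ≤-Reasoning

  -- The pendant edge contributes 2 to the degree sum, which pays for the extra vertex without a
  -- further tree.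
  bound⁺ : 2 * suc n ≤ degreeSum G + 2 * length F
  bound⁺ = begin
    2 * suc n                                     ≡⟨ *-suc 2 n ⟩
    2 + 2 * n                                     ≤⟨ +-monoʳ-≤ 2 bound ⟩
    2 + (degreeSum (delete G v) + 2 * length F)   ≡⟨ +-assoc 2 (degreeSum (delete G v)) _ ⟨
    2 + degreeSum (delete G v) + 2 * length F
      ≡⟨ cong (_+ 2 * length F)
           (trans (degreeSum-delete G v) (cong (λ d → 2 * d + degreeSum (delete G v)) deg≡1)) ⟨
    degreeSum G + 2 * length F                    ∎

  result : ∃[ F ] Embedding G F × 2 * suc n ≤ degreeSum G + 2 * length F
  -- A pendant vertex belongs to the component of its only neighbour `u`: a recorded tree containing
  -- `u` gains a leaf, and otherwise the recorded trees are untouched.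
  result with anyPos? F (λ q → punchIn v (vertex q) ≟ u)
  ... | yes (p , refl) =
    graft F p ,
    embedding-grow E (graft-growth F p) v-adj (λ w eq → p , sym (unique w eq)) ,
    subst (λ l → 2 * suc n ≤ degreeSum G + 2 * l) (sym (length-graft F p)) bound⁺
    where
    v-adj : ∀ q → adj G v (punchIn v (vertex q)) ≡ samePos F q p
    v-adj q with samePos F q p in same
    ... | true  = subst (λ q → adj G v (punchIn v (vertex q)) ≡ true)
                        (sym (samePos⇒≡ F q p same)) v~u
    ... | false with adj G v (punchIn v (vertex q)) in eq
    ...   | false = refl
    ...   | true
      with refl ← injective (punchIn-injective v _ _ (unique _ eq))
      with () ← trans (sym same) (samePos-refl F q)
  ... | no u∉F = F , embedding-keep E away , bound⁺
    where
    away : ∀ q → adj G v (punchIn v (vertex q)) ≡ false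
    away q with adj G v (punchIn v (vertex q)) in eq
    ... | false = refl
    ... | true  = contradiction (q , unique _ eq) u∉F

-- Handshake lemma

length-filter-tabulate : ∀ {A : Set} {P : A → Set} (P? : Unary.Decidable P) {n} (f : Fin n → A) →
  length (filter P? (tabulate f)) ≡ count (λ i → does (P? (f i)))
length-filter-tabulate P? {zero}  f = refl
length-filter-tabulate P? {suc n} f with does (P? (f zero))
... | true  = cong suc (length-filter-tabulate P? (f ∘ suc))
... | false = length-filter-tabulate P? (f ∘ suc)

length-filter-product : ∀ {A B : Set} {P : A × B → Set} (P? : Unary.Decidable P)
  {m n} (f : Fin m → A) (g : Fin n → B) →
  length (filter P? (cartesianProduct (tabulate f) (tabulate g))) ≡
  sum (λ i → count (λ j → does (P? (f i , g j))))
length-filter-product P? {zero}  f g = refl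
length-filter-product P? {suc m} f g = begin
  length (filter P? (row ++ rest))
    ≡⟨ cong length (filter-++ P? row rest) ⟩
  length (filter P? row ++ filter P? rest)
    ≡⟨ length-++ (filter P? row) ⟩
  length (filter P? row) + length (filter P? rest)
    ≡⟨ cong₂ _+_
         (trans (cong (length ∘ filter P?) (map-tabulate g (f zero ,_)))
                (length-filter-tabulate P? (λ j → f zero , g j)))
         (length-filter-product P? (f ∘ suc) g) ⟩
  sum (λ i → count (λ j → does (P? (f i , g j)))) ∎
  where
  open ≡-Reasoning
  row  = List.map (f zero ,_) (tabulate g)
  rest = cartesianProduct (tabulate (f ∘ suc)) (tabulate g)

-- `size` counts only pairs with i < j, so each entry of the adjacency matrix is split into `up i j`
-- and `up j i`; exchanging the summations shows that both parts have the same total.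
handshake : ∀ {n} (G : Graph n) → degreeSum G ≡ 2 * size G
handshake {n} G = begin
  degreeSum G
    ≡⟨ (sum-cong-≗ λ i → trans (sum-cong-≗ (split i)) (∑-distrib-+ (up i) (λ j → up j i))) ⟩
  sum (λ i → sum (up i) + sum (λ j → up j i))
    ≡⟨ ∑-distrib-+ (λ i → sum (up i)) _ ⟩
  sum (λ i → sum (up i)) + sum (λ i → sum (λ j → up j i))
    ≡⟨ cong (sum (λ i → sum (up i)) +_) (∑-comm up) ⟨
  sum (λ i → sum (up i)) + sum (λ i → sum (up i))
    ≡⟨ cong (λ m → m + m) (length-filter-product
         (λ (i , j) → (i <? j) ×-dec T? (adj G i j)) {n} {n} id id) ⟨
  size G + size G
    ≡⟨ cong (size G +_) (+-identityʳ (size G)) ⟨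
  2 * size G ∎
  where
  open ≡-Reasoning
  up : Fin n → Fin n → ℕ
  up i j = ind (does ((i <? j) ×-dec T? (adj G i j)))
  up-< : ∀ {i j} → i Fin.< j → up i j ≡ ind (adj G i j)
  up-< {i} {j} i<j = cong (λ b → ind (b ∧ adj G i j)) (dec-true (i <? j) i<j)
  up-≮ : ∀ {i j} → ¬ i Fin.< j → up i j ≡ 0
  up-≮ {i} {j} i≮j = cong (λ b → ind (b ∧ adj G i j)) (dec-false (i <? j) i≮j)
  split : ∀ i j → ind (adj G i j) ≡ up i j + up j i
  split i j with Fin.<-cmp i j
  ... | tri< i<j _ j≮i = sym (trans (cong₂ _+_ (up-< i<j) (up-≮ j≮i)) (+-identityʳ _))
  ... | tri≈ i≮j refl j≮i = trans (cong ind (adj-irrefl G i)) (sym (cong₂ _+_ (up-≮ i≮j) (up-≮ j≮i)))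
  ... | tri> i≮j _ j<i = trans (cong ind (adj-sym G i j)) (sym (cong₂ _+_ (up-≮ i≮j) (up-< j<i)))

-- Counting tree components

lookup-injective : ∀ {A : Set} {xs : List A} → Unique xs →
                   ∀ i j → List.lookup xs i ≡ List.lookup xs j → i ≡ j
lookup-injective (_ ∷ _)     zero    zero    _  = refl
lookup-injective (x∉ ∷ _)    zero    (suc j) eq = contradiction eq (All.lookup x∉ (∈-lookup j))
lookup-injective (x∉ ∷ _)    (suc i) zero    eq = contradiction (sym eq) (All.lookup x∉ (∈-lookup i))
lookup-injective (_ ∷ uniq) (suc i) (suc j) eq = cong suc (lookup-injective uniq i j eq)

unique⇒length≤ : ∀ {A : Set} {xs ys : List A} → Unique xs → xs ⊆ ys → length xs ≤ length ys
unique⇒length≤ {xs = xs} {ys} uniq xs⊆ys =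
  injective⇒≤ {f = λ i → index (xs⊆ys (∈-lookup {xs = xs} i))} λ {i} {j} eq →
    lookup-injective uniq i j
      (trans (lookup-index (xs⊆ys (∈-lookup {xs = xs} i)))
      (trans (cong (List.lookup ys) eq)
             (sym (lookup-index (xs⊆ys (∈-lookup {xs = xs} j))))))

order : Forest → ℕ
order []            = 0
order ((c , _) ∷ F) = suc c + order F

position : ∀ F → Fin (order F) → Pos F
position ((c , _) ∷ F) i = Sum.map₂ (position F) (splitAt (suc c) i)

position-injective : ∀ F i j → position F i ≡ position F j → i ≡ j
position-injective ((c , _) ∷ F) i j eq = begin
  i                                       ≡⟨ join-splitAt (suc c) (order F) i ⟨
  Fin.join (suc c) _ (splitAt (suc c) i)  ≡⟨ cong (Fin.join (suc c) _) (peel (splitAt (suc c) i) (splitAt (suc c) j) eq) ⟩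
  Fin.join (suc c) _ (splitAt (suc c) j)  ≡⟨ join-splitAt (suc c) (order F) j ⟩
  j                                       ∎
  where
  open ≡-Reasoning
  peel : ∀ s t → Sum.map₂ (position F) s ≡ Sum.map₂ (position F) t → s ≡ t
  peel (inj₁ _) (inj₁ _) refl = refl
  peel (inj₂ i) (inj₂ j) eq   = cong inj₂ (position-injective F i j (inj₂-injective eq))

order≤ : ∀ {n} {G : Graph n} {F} → Embedding G F → order F ≤ n
order≤ {F = F} E = injective⇒≤ {f = vertex ∘ position F}
  λ {i} {j} eq → position-injective F i j (injective eq)
  where open Embedding E

small? : ∀ k → Unary.Decidable {A = Tree} (λ C → proj₁ C < k)
small? k (c , _) = c ℕ.<? k

-- A tree of index at least `k` has at least `k + 1` vertices, which pay for its share `suc k` of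
-- the left side; the other trees are counted outright.
length≤small : ∀ k F → suc k * length F ≤ suc k * length (filter (small? k) F) + order F
length≤small k [] = ≤-reflexive (sym (+-identityʳ (suc k * 0)))
length≤small k (C@(c , _) ∷ F) with small? k C | length≤small k F
... | yes c<k | ih rewrite dec-true (small? k C) c<k = begin
  suc k * suc (length F)            ≡⟨ *-suc (suc k) (length F) ⟩
  suc k + suc k * length F          ≤⟨ +-monoʳ-≤ (suc k) ih ⟩
  suc k + (suc k * s + order F)     ≡⟨ +-assoc (suc k) (suc k * s) (order F) ⟨
  suc k + suc k * s + order F       ≡⟨ cong (_+ order F) (*-suc (suc k) s) ⟨
  suc k * suc s + order F           ≤⟨ +-monoʳ-≤ (suc k * suc s) (m≤n+m (order F) (suc c)) ⟩
  suc k * suc s + (suc c + order F) ∎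
  where
  open ≤-Reasoning
  s = length (filter (small? k) F)
... | no c≮k | ih rewrite dec-false (small? k C) c≮k = begin
  suc k * suc (length F)            ≡⟨ *-suc (suc k) (length F) ⟩
  suc k + suc k * length F          ≤⟨ +-mono-≤ (s≤s (≮⇒≥ c≮k)) ih ⟩
  suc c + (suc k * s + order F)     ≡⟨ x∙yz≈y∙xz (suc c) (suc k * s) (order F) ⟩
  suc k * s + (suc c + order F) ∎
  where
  open ≤-Reasoning
  s = length (filter (small? k) F)

codes : ∀ c → List (Code c)
codes zero    = root ∷ []
codes (suc c) = cartesianProductWith _▹_ (codes c) (allFin (suc c))

∈-codes : ∀ {c} (cd : Code c) → cd ∈ codes c
∈-codes root     = here refl
∈-codes (cd ▹ p) = ∈-cartesianProductWith⁺ _▹_ (∈-codes cd) (∈-allFin p)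

-- Isomorphic trees recur under different codes, so this overcounts; for the asymptotics it matters
-- only that the length is independent of `n`.
trees : ℕ → List Tree
trees k = List.concatMap (λ c → List.map (c ,_) (codes c)) (upTo k)

∈-trees : ∀ {k} (C : Tree) → proj₁ C < k → C ∈ trees k
∈-trees (c , cd) c<k =
  ∈-concatMap⁺ (λ c → List.map (c ,_) (codes c))
    (lose (∈-upTo⁺ c<k) (∈-map⁺ (c ,_) (∈-codes cd)))

-- At most length Cs tree components have at most k vertices, and there are at
-- most n / (k + 1) others.
asymmetric⇒size : ∀ {n} (G : Graph n) → Asymmetric G → ∀ k Cs →
  (∀ C → Rigid (codeAdj (proj₂ C)) → proj₁ C < k → C ∈ Cs) →
  suc k * n ≤ suc k * (size G + length Cs) + n
asymmetric⇒size {n} G asym k Cs complete with treeComponents G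
... | F , E , bound = begin
  suc k * n
    ≤⟨ *-monoʳ-≤ (suc k) n≤ ⟩
  suc k * (size G + length F)
    ≡⟨ *-distribˡ-+ (suc k) (size G) (length F) ⟩
  suc k * size G + suc k * length F
    ≤⟨ +-monoʳ-≤ (suc k * size G) (length≤small k F) ⟩
  suc k * size G + (suc k * length Fₛ + order F)
    ≤⟨ +-monoʳ-≤ (suc k * size G) (+-mono-≤ (*-monoʳ-≤ (suc k) few) (order≤ E)) ⟩
  suc k * size G + (suc k * length Cs + n)
    ≡⟨ +-assoc (suc k * size G) _ n ⟨
  suc k * size G + suc k * length Cs + n
    ≡⟨ cong (_+ n) (*-distribˡ-+ (suc k) (size G) (length Cs)) ⟨
  suc k * (size G + length Cs) + n ∎
  where
  open ≤-Reasoning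
  Fₛ = filter (small? k) F
  rigid : Rigid (forestAdj F)
  rigid = asymmetric⇒rigid asym E
  few : length Fₛ ≤ length Cs
  few = unique⇒length≤ (Unique.filter⁺ (small? k) (rigid⇒unique F rigid)) λ {C} C∈ →
    let C∈F , c<k = ∈-filter⁻ (small? k) {xs = F} C∈
    in complete C (All.lookup (rigid⇒all F rigid) C∈F) c<k
  n≤ : n ≤ size G + length F
  n≤ = *-cancelˡ-≤ 2 (begin
    2 * n                       ≤⟨ bound ⟩
    degreeSum G + 2 * length F  ≡⟨ cong (_+ 2 * length F) (handshake G) ⟩
    2 * size G + 2 * length F   ≡⟨ *-distribˡ-+ 2 (size G) (length F) ⟨
    2 * (size G + length F)     ∎)

-- For `k = 6` the single vertex is the only rigid small tree, so 7n ≤ 7(m + 1) + n with m edges.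
-- Bounding the last n by 1 + r + 7q, with r and q the remainder and quotient of n - 1 by 7, gives
-- 7n < 7(m + q + 3), hence n ≤ m + q + 2; the added 6 only completes a multiple of 7.
asymmetric⇒size-lower : ∀ {n} (G : Graph n) → Asymmetric G → n ∸ 2 ∸ (n ∸ 1) div 7 ≤ size G
asymmetric⇒size-lower {n} G asym =
  m≤n+o⇒m∸n≤o _ ((n ∸ 1) div 7) (m≤n+o⇒m∸n≤o n 2 (s≤s⁻¹ (*-cancelˡ-< 7 _ _ (begin-strict
    7 * n                      ≤⟨ asymmetric⇒size G asym 6 ((0 , root) ∷ []) only-root ⟩
    7 * (size G + 1) + n       ≤⟨ +-monoʳ-≤ (7 * (size G + 1)) (n≤ n) ⟩
    7 * (size G + 1) + (1 + (r + q * 7)) <⟨ +-monoʳ-< (7 * (size G + 1)) (s≤s (+-monoˡ-< (q * 7) (m%n<n (n ∸ 1) 7))) ⟩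
    7 * (size G + 1) + (1 + (7 + q * 7))      ≤⟨ m≤m+n _ 6 ⟩
    7 * (size G + 1) + (1 + (7 + q * 7)) + 6  ≡⟨ solve 2 (λ m q →
      con 7 :* (m :+ con 1) :+ (con 1 :+ (con 7 :+ q :* con 7)) :+ con 6 :=
      con 7 :* (con 1 :+ (con 2 :+ (q :+ m)))) refl (size G) q ⟩
    7 * suc (2 + (q + size G))  ∎))))
  where
  open ≤-Reasoning
  open +-*-Solver
  q = (n ∸ 1) div 7
  r = (n ∸ 1) % 7
  n≤ : ∀ n → n ≤ suc ((n ∸ 1) % 7 + (n ∸ 1) div 7 * 7)
  n≤ zero    = z≤n
  n≤ (suc n) = s≤s (≤-reflexive (m≡m%n+[m/n]*n n 7))
  only-root : ∀ C → Rigid (codeAdj (proj₂ C)) → proj₁ C < 6 → C ∈ (0 , root) ∷ []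
  only-root (zero  , root) _     _   = here refl
  only-root (suc _ , cd)   rigid c<6 with rigid-small cd rigid
  ... | inj₂ 6≤c = contradiction c<6 (≤⇒≯ 6≤c)

-- Asymmetric trees with an isolated vertex

-- Vertex 0 is isolated, 2 − 3 − 4 − ⋯ is a path, and 1 is attached to 4.
data Edge : ℕ → ℕ → Set where
  twig  : Edge 1 4
  twig′ : Edge 4 1
  up    : ∀ {i} → Edge (2 + i) (3 + i)
  down  : ∀ {i} → Edge (3 + i) (2 + i)

-- The same graph is described twice: `link` computes and defines the adjacency, while proofs match
-- on `Edge`.
link : ℕ → ℕ → Bool
link 0             _ = false
link 1             j = j ≡ᵇ 4
link (suc (suc i)) j = j ≡ᵇ 3 + i

Edge-sym : ∀ {i j} → Edge i j → Edge j i
Edge-sym twig  = twig′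
Edge-sym twig′ = twig
Edge-sym up    = down
Edge-sym down  = up

Edge-irrefl : ∀ {i} → ¬ Edge i i
Edge-irrefl ()

link⇒Edge : ∀ i j → T (link i j) → Edge i j
link⇒Edge 1             j l with refl ← ≡ᵇ⇒≡ j 4 l       = twig
link⇒Edge (suc (suc i)) j l with refl ← ≡ᵇ⇒≡ j (3 + i) l = up

∨⇒Edge : ∀ i j → T (link i j ∨ link j i) → Edge i j
∨⇒Edge i j e with link i j in eq
... | true  = link⇒Edge i j (subst T (sym eq) _)
... | false = Edge-sym (link⇒Edge j i e)

Edge⇒∨ : ∀ {i j} → Edge i j → T (link i j ∨ link j i)
Edge⇒∨ twig  = _
Edge⇒∨ twig′ = _
Edge⇒∨ (up {i}) with link (2 + i) (3 + i) in eq
... | true  = _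
... | false = contradiction (subst T eq (≡⇒≡ᵇ (3 + i) _ refl)) id
Edge⇒∨ (down {i}) = subst T (∨-comm (link (2 + i) (3 + i)) _) (Edge⇒∨ (up {i}))

spider : ∀ n → Graph n
spider n = record
  { adj        = λ i j → link (toℕ i) (toℕ j) ∨ link (toℕ j) (toℕ i)
  ; adj-sym    = λ i j → ∨-comm (link (toℕ i) (toℕ j)) _
  ; adj-irrefl = irrefl
  }
  where
  irrefl : ∀ (i : Fin n) → link (toℕ i) (toℕ i) ∨ link (toℕ i) (toℕ i) ≡ false
  irrefl i with link (toℕ i) (toℕ i) ∨ link (toℕ i) (toℕ i) in eq
  ... | false = refl
  ... | true  = contradiction (∨⇒Edge (toℕ i) _ (subst T (sym eq) _)) Edge-irrefl

-- Vertex 4 is the only branching one, so every automorphism fixes it.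
three-neighbours : ∀ {v a b c} → Edge v a → Edge v b → Edge v c →
                   a ≢ b → a ≢ c → b ≢ c → v ≡ 4
three-neighbours twig  twig  _     a≢b _ _ = contradiction refl a≢b
three-neighbours twig′ _     _     _   _ _ = refl
three-neighbours up    twig′ _     _   _ _ = refl
three-neighbours up    up    _     a≢b _ _ = contradiction refl a≢b
three-neighbours up    down  twig′ _   _ _ = refl
three-neighbours up    down  up    _ a≢c _ = contradiction refl a≢c
three-neighbours up    down  down  _ _ b≢c = contradiction refl b≢c
three-neighbours down  twig′ _     _   _ _ = refl
three-neighbours down  down  _     a≢b _ _ = contradiction refl a≢b
three-neighbours down  up    twig′ _   _ _ = refl
three-neighbours down  up    up    _ _ b≢c = contradiction refl b≢c
three-neighbours down  up    down  _ a≢c _ = contradiction refl a≢c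

module _ {k : ℕ} where

  private n = 8 + k

  Leaf : ℕ → Set
  Leaf x = ∀ (a b : Fin n) → Edge x (toℕ a) → Edge x (toℕ b) → a ≡ b

  leaf-at-4 : ∀ {x} → Edge 4 x → Leaf x → x ≡ 1
  leaf-at-4 twig′ _ = refl
  leaf-at-4 up leaf with () ← leaf 4F 6F down up
  leaf-at-4 down leaf with () ← leaf 2F 4F down up

  short-leg-at-4 : ∀ {x y} → Edge 4 x → x ≢ 1 → Edge x y → y ≢ 4 → Leaf y → x ≡ 3
  short-leg-at-4 twig′ x≢1 _    _   _ = contradiction refl x≢1
  short-leg-at-4 down  _   _    _   _ = refl
  short-leg-at-4 up    _   down y≢4 _ = contradiction refl y≢4
  -- Here `x` is 5 and `y` is 6. Vertex 7 exists because `n` is at least 8, so 6 is not a leaf: this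
  -- tells the long leg from the leg of length two.
  short-leg-at-4 up    _   up   _   leaf with () ← leaf 5F 7F down up

  long-leg-at-4 : ∀ {x} → Edge 4 x → x ≢ 1 → x ≢ 3 → x ≡ 5
  long-leg-at-4 twig′ x≢1 _   = contradiction refl x≢1
  long-leg-at-4 down  _   x≢3 = contradiction refl x≢3
  long-leg-at-4 up    _   _   = refl

  end-at-3 : ∀ {x} → Edge 3 x → x ≢ 4 → x ≡ 2
  end-at-3 up   x≢4 = contradiction refl x≢4
  end-at-3 down _   = refl

  next-on-leg : ∀ {i x} → Edge (5 + i) x → x ≢ 4 + i → x ≡ 6 + i
  next-on-leg up   _ = refl
  next-on-leg down x≢ = contradiction refl x≢

  -- The vertices are pinned in turn: 4 as the branching vertex, 1 as its leaf neighbour, 3 as its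
  -- neighbour with a leaf beyond, then 2 and 5 by exclusion. Along the long leg each vertex is the
  -- neighbour of its predecessor that is not yet taken, and 0 is what remains.
  spider-asymmetric : Asymmetric (spider n)
  spider-asymmetric π auto = fixed
    where
    f : Fin n → Fin n
    f = π ⟨$⟩ʳ_
    F : Fin n → ℕ
    F = toℕ ∘ f

    F-distinct : ∀ {u v m} → F v ≡ m → u ≢ v → F u ≢ m
    F-distinct Fv u≢v Fu = u≢v (Injection.injective (↔⇒↣ π) (Fin.toℕ-injective (trans Fu (sym Fv))))

    f-edge : ∀ u v → Edge (toℕ u) (toℕ v) → Edge (F u) (F v)
    f-edge u v e = ∨⇒Edge (F u) (F v) (subst T (sym (auto u v)) (Edge⇒∨ e))

    f-edge⁻ : ∀ u v → Edge (F u) (F v) → Edge (toℕ u) (toℕ v)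
    f-edge⁻ u v e = ∨⇒Edge (toℕ u) (toℕ v) (subst T (auto u v) (Edge⇒∨ e))

    f-leaf : ∀ u → Leaf (toℕ u) → Leaf (F u)
    f-leaf u leaf a b ea eb =
      trans (sym (inverseʳ π)) (trans (cong f (leaf _ _ (back a ea) (back b eb))) (inverseʳ π))
      where
      back : ∀ a → Edge (F u) (toℕ a) → Edge (toℕ u) (toℕ (π ⟨$⟩ˡ a))
      back a e = f-edge⁻ u _ (subst (Edge (F u) ∘ toℕ) (sym (inverseʳ π)) e)

    1-leaf : Leaf 1
    1-leaf a b ea eb = Fin.toℕ-injective (trans (only ea) (sym (only eb)))
      where
      only : ∀ {x} → Edge 1 x → x ≡ 4
      only twig = refl

    2-leaf : Leaf 2
    2-leaf a b ea eb = Fin.toℕ-injective (trans (only ea) (sym (only eb)))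
      where
      only : ∀ {x} → Edge 2 x → x ≡ 3
      only up = refl

    F4 : F 4F ≡ 4
    F4 = three-neighbours (f-edge 4F 1F twig′) (f-edge 4F 3F down) (f-edge 4F 5F up)
           (distinct λ ()) (distinct λ ()) (distinct λ ())
      where
      distinct : ∀ {u v} → u ≢ v → F u ≢ F v
      distinct = F-distinct refl

    from-4 : ∀ u → Edge 4 (toℕ u) → Edge 4 (F u)
    from-4 u e = subst (λ x → Edge x (F u)) F4 (f-edge 4F u e)

    F1 : F 1F ≡ 1
    F1 = leaf-at-4 (from-4 1F twig′) (f-leaf 1F 1-leaf)

    F3 : F 3F ≡ 3
    F3 = short-leg-at-4 (from-4 3F down) (F-distinct F1 λ ()) (f-edge 3F 2F down)
           (F-distinct F4 λ ()) (f-leaf 2F 2-leaf)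

    F2 : F 2F ≡ 2
    F2 = end-at-3 (subst (λ x → Edge x (F 2F)) F3 (f-edge 3F 2F down)) (F-distinct F4 λ ())

    F5 : F 5F ≡ 5
    F5 = long-leg-at-4 (from-4 5F up) (F-distinct F1 λ ()) (F-distinct F3 λ ())

    -- Vacuous unless `m` is below `n`, so the induction along the leg can run over all naturals.
    Fixed : ℕ → Set
    Fixed m = ∀ v → toℕ v ≡ m → F v ≡ m

    fixed-at : ∀ u {m} → toℕ u ≡ m → F u ≡ m → Fixed m
    fixed-at u u≡m Fu v v≡m with refl ← Fin.toℕ-injective {i = u} {j = v} (trans u≡m (sym v≡m)) = Fu

    leg : ∀ i → Fixed (4 + i) × Fixed (5 + i)
    leg zero    = fixed-at 4F refl F4 , fixed-at 5F refl F5
    leg (suc i) = proj₂ (leg i) , next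
      where
      next : Fixed (6 + i)
      next v v≡ = next-on-leg
        (subst₂ Edge (proj₂ (leg i) u u≡) refl (f-edge u v (subst₂ Edge (sym u≡) (sym v≡) up)))
        (F-distinct (proj₁ (leg i) w w≡) λ v≡w → 4+i≢6+i (trans (sym w≡) (trans (cong toℕ (sym v≡w)) v≡)))
        where
        6+i<n : 6 + i < n
        6+i<n = subst (_< n) v≡ (toℕ<n v)
        5+i<n : 5 + i < n
        5+i<n = <-trans (n<1+n _) 6+i<n
        u = fromℕ< 5+i<n
        u≡ : toℕ u ≡ 5 + i
        u≡ = toℕ-fromℕ< 5+i<n
        w = fromℕ< (<-trans (n<1+n _) 5+i<n)
        w≡ : toℕ w ≡ 4 + i
        w≡ = toℕ-fromℕ< (<-trans (n<1+n _) 5+i<n)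
        4+i≢6+i : ∀ {i} → 4 + i ≢ 6 + i
        4+i≢6+i {suc i} eq = 4+i≢6+i (suc-injective eq)

    fixed⁺ : ∀ v → v ≢ 0F → f v ≡ v
    fixed⁺ 0F v≢0 = contradiction refl v≢0
    fixed⁺ 1F _ = Fin.toℕ-injective F1
    fixed⁺ 2F _ = Fin.toℕ-injective F2
    fixed⁺ 3F _ = Fin.toℕ-injective F3
    fixed⁺ v@(suc (suc (suc (suc i)))) _ = Fin.toℕ-injective (proj₁ (leg (toℕ i)) v refl)

    fixed : ∀ v → f v ≡ v
    fixed v@(suc _) = fixed⁺ v λ ()
    -- If 0 moved, its image would be a fixed point, and injectivity would make that image 0 after
    -- all.
    fixed 0F with f 0F ≟ 0F
    ... | yes f0 = f0
    ... | no f0≢0 = contradiction (Injection.injective (↔⇒↣ π) (fixed⁺ (f 0F) f0≢0)) f0≢0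

  spiderEdges : List (Fin n × Fin n)
  spiderEdges = (1F , 4F) ∷ List.tabulate {n = 5 + k} (λ i → suc (suc (inject₁ i)) , suc (suc (suc i)))

  ∈-spiderEdges : ∀ {a b} (i j : Fin n) → Edge a b → toℕ i ≡ a → toℕ j ≡ b → a < b →
                  (i , j) ∈ spiderEdges
  ∈-spiderEdges i j twig  i≡ j≡ _
    with refl ← Fin.toℕ-injective {i = i} {j = 1F} i≡ | refl ← Fin.toℕ-injective {i = j} {j = 4F} j≡ = here refl
  ∈-spiderEdges i j twig′ i≡ j≡ (s≤s ())
  ∈-spiderEdges (suc (suc i)) (suc (suc (suc j))) up refl j≡ _
    with refl ← Fin.toℕ-injective {i = i} {j = inject₁ j}
                  (trans (sym (suc-injective (suc-injective (suc-injective j≡)))) (sym (toℕ-inject₁ j)))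
    = there (∈-tabulate⁺ {f = λ i → suc (suc (inject₁ i)) , suc (suc (suc i))} j)
  ∈-spiderEdges i j down  i≡ j≡ a<b = contradiction a<b (<⇒≯ (n<1+n _))

  spider-size : size (spider n) ≤ 6 + k
  spider-size = ≤-trans
    (unique⇒length≤ (Unique.filter⁺ Q? (Unique.cartesianProduct⁺ (Unique.allFin⁺ n) (Unique.allFin⁺ n)))
      λ {(i , j)} ij∈ →
        let _ , i<j , e = ∈-filter⁻ Q? {xs = cartesianProduct (allFin n) (allFin n)} ij∈
        in ∈-spiderEdges i j (∨⇒Edge (toℕ i) (toℕ j) e) refl refl i<j)
    (≤-reflexive (cong suc (length-tabulate {n = 5 + k} (λ i → suc (suc (inject₁ i)) , suc (suc (suc i))))))
    where
    Q? : (p : Fin n × Fin n) → Dec (proj₁ p Fin.< proj₂ p × T (adj (spider n) (proj₁ p) (proj₂ p)))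
    Q? (i , j) = (i <? j) ×-dec T? (adj (spider n) i j)

-- Asymmetric graphs on six and seven vertices

module Backtracking {n} (G : Graph n) where

  Compatible : Fin n → Fin n → Fin n × Fin n → Set
  Compatible v w (u , x) = does (w ≟ x) ≡ does (v ≟ u) × adj G w x ≡ adj G v u

  compatible? : ∀ v w ux → Dec (Compatible v w ux)
  compatible? v w (u , x) =
    (does (w ≟ x) Bool.≟ does (v ≟ u)) ×-dec (adj G w x Bool.≟ adj G v u)

  -- Every extension to vs of the partial automorphism whose graph is done is
  -- the identity.
  Forced : List (Fin n) → List (Fin n × Fin n) → Set
  Forced []       done = All (λ (u , x) → x ≡ u) done
  Forced (v ∷ vs) done = ∀ w → All (Compatible v w) done → Forced vs ((v , w) ∷ done)

  -- An image `w` that clashes with an earlier choice satisfies the implication vacuously, which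
  -- prunes the search.
  forced? : ∀ vs done → Dec (Forced vs done)
  forced? []       done = All.all? (λ (u , x) → x ≟ u) done
  forced? (v ∷ vs) done =
    all? λ w → All.all? (compatible? v w) done →-dec forced? vs ((v , w) ∷ done)

  -- Choosing the image `f v` at every vertex selects one branch of `Forced`; its compatibility
  -- conditions hold because `f` is injective and preserves adjacency.
  forced⇒asymmetric : Forced (allFin n) [] → Asymmetric G
  forced⇒asymmetric forced π auto v =
    All.lookup (proj₁ (extend (allFin n) [] [] forced)) (∈-allFin v)
    where
    f = π ⟨$⟩ʳ_

    OnGraph : Fin n × Fin n → Set
    OnGraph (u , x) = x ≡ f u

    does-f : ∀ v u → does (f v ≟ f u) ≡ does (v ≟ u)
    does-f v u with v ≟ u
    ... | yes refl = dec-true (f v ≟ f v) refl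
    ... | no v≢u   = dec-false (f v ≟ f u) (v≢u ∘ Injection.injective (↔⇒↣ π))

    extend : ∀ vs done → All OnGraph done → Forced vs done →
             All (λ v → f v ≡ v) vs × All (λ (u , x) → x ≡ u) done
    extend []       done on forced = [] , forced
    extend (v ∷ vs) done on forced
      with extend vs ((v , f v) ∷ done) (refl ∷ on)
             (forced (f v) (All.map (λ { refl → does-f v _ , auto v _ }) on))
    ... | vs-fixed , v-fixed ∷ done-fixed = v-fixed ∷ vs-fixed , done-fixed

-- The path 0 − 1 − 2 − 3 − 4 with a vertex 5 joined to 1 and 2, and isolated
-- vertices from 6 on.
sun : ℕ → ℕ → Bool
sun 0 1 = true
sun 1 2 = true
sun 2 3 = true
sun 3 4 = true
sun 1 5 = true
sun 2 5 = true
sun _ _ = false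

symmetrised : (b : ℕ → ℕ → Bool) → ∀ n →
  {True (all? {n = n} λ i → (b (toℕ i) (toℕ i) ∨ b (toℕ i) (toℕ i)) Bool.≟ false)} → Graph n
symmetrised b n {irrefl} = record
  { adj        = λ i j → b (toℕ i) (toℕ j) ∨ b (toℕ j) (toℕ i)
  ; adj-sym    = λ i j → ∨-comm (b (toℕ i) (toℕ j)) _
  ; adj-irrefl = toWitness irrefl
  }

sun₆-asymmetric : Asymmetric (symmetrised sun 6)
sun₆-asymmetric = forced⇒asymmetric (from-yes (forced? (allFin 6) []))
  where open Backtracking (symmetrised sun 6)

sun₇-asymmetric : Asymmetric (symmetrised sun 7)
sun₇-asymmetric = forced⇒asymmetric (from-yes (forced? (allFin 7) []))
  where open Backtracking (symmetrised sun 7)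

-- Exhaustive search

-- Functions are found only up to pointwise equality, hence the relation that `P` must respect.
Searchable : (A : Set) → Rel A 0ℓ → Set₁
Searchable A _≈_ = {P : A → Set} → (∀ x → Dec (P x)) →
                   (∀ {x y} → x ≈ y → P x → P y) → Dec (∃ P)

search-Fin : ∀ {n} → Searchable (Fin n) _≡_
search-Fin P? _ = any? P?

search-Bool : Searchable Bool _≡_
search-Bool P? _ with P? true | P? false
... | yes p | _     = yes (true , p)
... | no _  | yes p = yes (false , p)
... | no ¬p | no ¬q = no λ { (true , p) → ¬p p ; (false , q) → ¬q q }

search-→ : ∀ {A : Set} {_≈_ : Rel A 0ℓ} → (∀ {x} → x ≈ x) → Searchable A _≈_ →
           ∀ n → Searchable (Fin n → A) (λ f g → ∀ i → f i ≈ g i)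
search-→ ≈-refl search zero P? resp =
  map′ (_ ,_) (λ (f , p) → resp {f} {empty} (λ ()) p) (P? empty)
  where
  empty : Fin 0 → _
  empty ()
search-→ {_≈_ = _≈_} ≈-refl search (suc n) P? resp =
  map′ (λ (x , f , p) → x Vector.∷ f , p)
       (λ (f , p) → f zero , f ∘ suc , resp (λ { zero → ≈-refl ; (suc i) → ≈-refl }) p)
       (search (λ x → search-→ {_≈_ = _≈_} ≈-refl search n (λ f → P? (x Vector.∷ f))
                  λ f≈g → resp λ { zero → ≈-refl ; (suc i) → f≈g i })
               λ x≈y (f , p) → f , resp (λ { zero → x≈y ; (suc i) → ≈-refl }) p)

least : ∀ {P : ℕ → Set} → (∀ m → Dec (P m)) → ∀ m → P m → ∃ (IsLeast P)
least {P} P? m pm with below (suc m)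
  where
  below : ∀ n → ∃ (IsLeast P) ⊎ (∀ k → k < n → ¬ P k)
  below zero = inj₂ λ _ ()
  below (suc n) with below n
  ... | inj₁ found = inj₁ found
  ... | inj₂ none with P? n
  ...   | yes pn = inj₁ (n , pn , λ k pk → ≮⇒≥ λ k<n → none k k<n pk)
  ...   | no ¬pn = inj₂ λ k k<1+n pk → case-≤ k pk (s≤s⁻¹ k<1+n)
    where
    case-≤ : ∀ k → P k → ¬ k ≤ n
    case-≤ k pk k≤n with m≤n⇒m<n∨m≡n k≤n
    ... | inj₁ k<n  = none k k<n pk
    ... | inj₂ refl = ¬pn pk
... | inj₁ found = found
... | inj₂ none  = contradiction pm (none m ≤-refl)

countPairs-cong : ∀ {n} {P Q : Rel (Fin n) 0ℓ} (P? : Decidable P) (Q? : Decidable Q) →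
                  (∀ {i j} → P i j → Q i j) → (∀ {i j} → Q i j → P i j) →
                  countPairs P? ≡ countPairs Q?
countPairs-cong {n} P? Q? P⇒Q Q⇒P = cong length (filter-≐
  (λ (i , j) → (i <? j) ×-dec P? i j) (λ (i , j) → (i <? j) ×-dec Q? i j)
  ((λ (i<j , p) → i<j , P⇒Q p) , (λ (i<j , q) → i<j , Q⇒P q))
  (cartesianProduct (allFin n) (allFin n)))

-- Deciding asymmetry

module _ {n : ℕ} where

  Adjacency : Set
  Adjacency = Fin n → Fin n → Bool

  Asymmetricᵃ : Adjacency → Set
  Asymmetricᵃ a = (π : Permutation′ n) → (∀ i j → a (π ⟨$⟩ʳ i) (π ⟨$⟩ʳ j) ≡ a i j) → IsIdentity π

  sizeᵃ : Adjacency → ℕ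
  sizeᵃ a = countPairs (λ i j → T? (a i j))

  -- Permutations, like graphs below, are unpacked into plain functions with decidable conditions,
  -- which is the form that `search-→` can enumerate.
  NontrivialAutomorphism : Adjacency → (Fin n → Fin n) → (Fin n → Fin n) → Set
  NontrivialAutomorphism a f g =
    (∀ i → f (g i) ≡ i) × (∀ i → g (f i) ≡ i) ×
    (∀ i j → a (f i) (f j) ≡ a i j) × (∃[ i ] f i ≢ i)

  nontrivialAutomorphism? : ∀ a → Dec (∃[ f ] ∃[ g ] NontrivialAutomorphism a f g)
  nontrivialAutomorphism? a =
    search-→ {_≈_ = _≡_} refl search-Fin n
      (λ f → search-→ {_≈_ = _≡_} refl search-Fin n
        (λ g → all? (λ i → f (g i) ≟ i) ×-dec all? (λ i → g (f i) ≟ i) ×-dec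
               all? (λ i → all? λ j → a (f i) (f j) Bool.≟ a i j) ×-dec
               any? (λ i → ¬? (f i ≟ i)))
        (resp λ _ → refl))
      (λ f≗f′ (g , na) → g , resp f≗f′ (λ _ → refl) na)
    where
    resp : ∀ {f f′ g g′} → (∀ i → f i ≡ f′ i) → (∀ i → g i ≡ g′ i) →
           NontrivialAutomorphism a f g → NontrivialAutomorphism a f′ g′
    resp {f} {f′} {g} {g′} f≗ g≗ (fg , gf , auto , i , fi≢i) =
      (λ i → trans (sym (trans (f≗ (g i)) (cong f′ (g≗ i)))) (fg i)) ,
      (λ i → trans (sym (trans (g≗ (f i)) (cong g′ (f≗ i)))) (gf i)) ,
      (λ i j → trans (sym (cong₂ a (f≗ i) (f≗ j))) (auto i j)) ,
      i , λ f′i≡i → fi≢i (trans (f≗ i) f′i≡i)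

  asymmetric? : ∀ a → Dec (Asymmetricᵃ a)
  asymmetric? a = map′
    (λ none π auto i → decidable-stable (π ⟨$⟩ʳ i ≟ i) λ πi≢i →
      none (π ⟨$⟩ʳ_ , π ⟨$⟩ˡ_ , (λ _ → inverseʳ π) , (λ _ → inverseˡ π) , auto , i , πi≢i))
    (λ { asym (f , g , fg , gf , auto , i , fi≢i) →
      fi≢i (asym (permutation f g fg gf) auto i) })
    (¬? (nontrivialAutomorphism? a))

  AsymmetricOfSize : ℕ → Adjacency → Set
  AsymmetricOfSize m a =
    (∀ i j → a i j ≡ a j i) × (∀ i → a i i ≡ false) × Asymmetricᵃ a × sizeᵃ a ≡ m

  asymmetricOfSize-resp : ∀ {m a a′} → (∀ i j → a i j ≡ a′ i j) →
                          AsymmetricOfSize m a → AsymmetricOfSize m a′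
  asymmetricOfSize-resp a≗ (symm , irr , asym , refl) =
    (λ i j → trans (sym (a≗ i j)) (trans (symm i j) (a≗ j i))) ,
    (λ i → trans (sym (a≗ i i)) (irr i)) ,
    (λ π auto → asym π λ i j → trans (a≗ _ _) (trans (auto i j) (sym (a≗ i j)))) ,
    countPairs-cong _ _ (λ {i} {j} → subst T (sym (a≗ i j))) (λ {i} {j} → subst T (a≗ i j))

asymmetricOfSize? : ∀ n m → Dec (Σ[ G ∈ Graph n ] Asymmetric G × size G ≡ m)
asymmetricOfSize? n m = map′
  (λ (a , symm , irr , asym-size) →
    record { adj = a ; adj-sym = symm ; adj-irrefl = irr } , asym-size)
  (λ (G , asym-size) → adj G , adj-sym G , adj-irrefl G , asym-size)
  (search-→ {_≈_ = λ r r′ → ∀ i → r i ≡ r′ i} (λ _ → refl)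
    (search-→ {_≈_ = _≡_} refl search-Bool n) n
    (λ a → all? (λ i → all? λ j → a i j Bool.≟ a j i) ×-dec
           all? (λ i → a i i Bool.≟ false) ×-dec
           asymmetric? a ×-dec (sizeᵃ a ℕ.≟ m))
    asymmetricOfSize-resp)

asymmetric-exists : ∀ n → 6 ≤ n → ∃[ G ] Asymmetric {n} G
asymmetric-exists 6 _ = symmetrised sun 6 , sun₆-asymmetric
asymmetric-exists 7 _ = symmetrised sun 7 , sun₇-asymmetric
asymmetric-exists (suc (suc (suc (suc (suc (suc (suc (suc k)))))))) _ = spider (8 + k) , spider-asymmetric
asymmetric-exists 0 ()
asymmetric-exists 1 (s≤s ())
asymmetric-exists 2 (s≤s (s≤s ()))
asymmetric-exists 3 (s≤s (s≤s (s≤s ())))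
asymmetric-exists 4 (s≤s (s≤s (s≤s (s≤s ()))))
asymmetric-exists 5 (s≤s (s≤s (s≤s (s≤s (s≤s ())))))

minAsymmetric : ∀ n → 6 ≤ n → ∃ (IsMinAsymmetricSize n)
minAsymmetric n 6≤n with G , asym ← asymmetric-exists n 6≤n =
  least (asymmetricOfSize? n) (size G) (G , asym , refl)

-- Edge colourings of complete graphs

T-does : ∀ {P : Set} (P? : Dec P) → T (does P?) → P
T-does (yes p) _ = p

does-T : ∀ {P : Set} (P? : Dec P) → P → T (does P?)
does-T (yes _) _ = _
does-T (no ¬p) p = ¬p p

K-adjacent : ∀ {n} {i j : Fin n} → i ≢ j → Adj (K n) i j
K-adjacent {i = i} {j} i≢j with i ≟ j
... | yes i≡j = i≢j i≡j
... | no _    = _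

K-distinct : ∀ {n} {i j : Fin n} → Adj (K n) i j → i ≢ j
K-distinct {i = i} {j} e with i ≟ j
... | no i≢j = i≢j

K-automorphism : ∀ {n} (π : Permutation′ n) → IsAutomorphism (K n) π
K-automorphism π i j with (π ⟨$⟩ʳ i) ≟ (π ⟨$⟩ʳ j) | i ≟ j
... | yes _ | yes _ = refl
... | no _  | no _  = refl
... | yes p | no ¬q = contradiction (Injection.injective (↔⇒↣ π) p) ¬q
... | no ¬p | yes q = contradiction (cong (π ⟨$⟩ʳ_) q) ¬p

module _ {n} (c : EdgeColouring (K n) 2) (k : Fin 2) where

  classGraph : Graph n
  classGraph = record
    { adj        = λ i j → does (inClass? c k i j)
    ; adj-sym    = λ i j → does-⇔ (mk⇔ flip flip) (inClass? c k i j) (inClass? c k j i)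
    ; adj-irrefl = λ i → dec-false (inClass? c k i i) λ (e , _) → K-distinct e refl
    }
    where
    flip : ∀ {i j} → InClass c k i j → InClass c k j i
    flip {i} {j} (e , eq) = e′ , trans (colour-sym c j i e′ e) eq
      where e′ = K-adjacent (K-distinct e ∘ sym)

  size-classGraph : size classGraph ≡ classSize c k
  size-classGraph = countPairs-cong _ (inClass? c k)
    (λ {i} {j} → T-does (inClass? c k i j)) (λ {i} {j} → does-T (inClass? c k i j))

  -- Every permutation is an automorphism of `K n`, and with two colours a permutation that
  -- preserves one class preserves the other (`two`).
  classGraph-asymmetric : Distinguishing c → Asymmetric classGraph
  classGraph-asymmetric dist π auto = dist π (K-automorphism π) preserves
    where
    two : ∀ {x y z : Fin 2} → (x ≡ z → y ≡ z) → (y ≡ z → x ≡ z) → x ≡ y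
    two {0F} {0F} {z}  _ _ = refl
    two {1F} {1F} {z}  _ _ = refl
    two {0F} {1F} {0F} f _ with () ← f refl
    two {0F} {1F} {1F} _ g with () ← g refl
    two {1F} {0F} {0F} _ g with () ← g refl
    two {1F} {0F} {1F} f _ with () ← f refl

    transfer : ∀ {i j i′ j′} (e : Adj (K n) i j) (e′ : Adj (K n) i′ j′) →
               adj classGraph i j ≡ adj classGraph i′ j′ →
               colour c i j e ≡ k → colour c i′ j′ e′ ≡ k
    transfer {i} {j} {i′} {j′} e e′ eq col
      with e″ , col′ ← T-does (inClass? c k i′ j′) (subst T eq (does-T (inClass? c k i j) (e , col))) =
      trans (cong (colour c i′ j′) (Bool.T-irrelevant e′ e″)) col′

    preserves : Preserves π c
    preserves i j e e′ = two {z = k} (transfer e′ e (auto i j)) (transfer e e′ (sym (auto i j)))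

module _ {n} (G : Graph n) where

  shade : Bool → Fin 2
  shade b = if b then 0F else 1F

  shade-injective : ∀ {a b} → shade a ≡ shade b → a ≡ b
  shade-injective {true}  {true}  _ = refl
  shade-injective {false} {false} _ = refl

  colouring : EdgeColouring (K n) 2
  colouring = record
    { colour     = λ i j _ → shade (adj G i j)
    ; colour-sym = λ i j _ _ → cong shade (adj-sym G i j)
    }

  colouring-distinguishing : Asymmetric G → Distinguishing colouring
  colouring-distinguishing asym π _ preserves = asym π auto
    where
    auto : IsAutomorphism G π
    auto i j with i ≟ j
    ... | yes refl = trans (adj-irrefl G _) (sym (adj-irrefl G i))
    ... | no i≢j   = shade-injective
      (preserves i j (K-adjacent i≢j) (K-adjacent (i≢j ∘ Injection.injective (↔⇒↣ π))))

  colouring-class : classSize colouring 0F ≡ size G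
  colouring-class = countPairs-cong (inClass? colouring 0F) (λ i j → T? (adj G i j)) to from
    where
    to : ∀ {i j} → InClass colouring 0F i j → T (adj G i j)
    to (_ , eq) = subst T (sym (shade-injective {b = true} eq)) _
    from : ∀ {i j} → T (adj G i j) → InClass colouring 0F i j
    from {i} {j} t = K-adjacent (λ { refl → subst T (adj-irrefl G i) t }) , shaded t
      where
      shaded : ∀ {b} → T b → shade b ≡ 0F
      shaded {true} _ = refl

-- Without colours the edge between 0 and 1 cannot be coloured; with a single colour, exchanging 0
-- and 1 preserves the colouring.
distinguishing⇒2≤ : ∀ {n d} {c : EdgeColouring (K (2 + n)) d} → Distinguishing c → 2 ≤ d
distinguishing⇒2≤ {d = 0} {c} _ with () ← colour c 0F 1F _
distinguishing⇒2≤ {n} {d = 1} {c} dist =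
  contradiction (dist swap (K-automorphism swap) (λ i j e e′ → unique _ _) 0F) λ ()
  where
  swap : Permutation′ (2 + n)
  swap = transpose 0F 1F
  unique : (x y : Fin 1) → x ≡ y
  unique 0F 0F = refl
distinguishing⇒2≤ {d = suc (suc _)} _ = s≤s (s≤s z≤n)

-- The second class of `colouring G` is the complement of `G`. It is asymmetric too, hence no
-- smaller than the minimum `size G`, so the smaller class has exactly `size G` edges.
minAsymmetric⇒cost : ∀ {n r} → 2 ≤ n → IsMinAsymmetricSize n r → IsCost (K n) r
minAsymmetric⇒cost {suc (suc n)} {r} _ ((G , asym , refl) , minimal) =
  ((colouring G , distinguishing) , λ d (c , dist) → distinguishing⇒2≤ {c = c} dist) ,
  (colouring G , distinguishing , trans (cong (_⊓ size₁) (colouring-class G)) (m≤n⇒m⊓n≡m (≤-class distinguishing 1F))) ,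
  λ m (c , dist , eq) → subst (size G ≤_) eq (⊓-glb (≤-class dist 0F) (≤-class dist 1F))
  where
  distinguishing = colouring-distinguishing G asym
  size₁ = classSize (colouring G) 1F
  ≤-class : ∀ {c} → Distinguishing c → ∀ k → size G ≤ classSize c k
  ≤-class {c} dist k = minimal _
    (classGraph c k , classGraph-asymmetric c k dist , size-classGraph c k)
minAsymmetric⇒cost {1} (s≤s ())

-- Asymptotics

open import Data.Integer.Base using (+_; -[1+_]; +<+)
import Data.Integer.Base as ℤ
import Data.Integer.Properties as ℤ
open import Data.Rational.Base using (ℚ; mkℚ; 0ℚ; 1ℚ; _/_; _-_; ∣_∣; toℚᵘ; *<*)
import Data.Rational.Base as ℚ
import Data.Rational.Properties as ℚ
open import Data.Rational.Unnormalised.Base using (mkℚᵘ; 1ℚᵘ)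
import Data.Rational.Unnormalised.Base as ℚᵘ
import Data.Rational.Unnormalised.Properties as ℚᵘ

-- The left side is (n - ρ) / n, and a positive rational with denominator q is at least 1 / q.
∣ρ/n-1∣<ε : ∀ {ρ n} .{{_ : NonZero n}} {ε} → 0ℚ ℚ.< ε → ρ ≤ n → ℚ.↧ₙ ε * (n ∸ ρ) < n →
            ∣ (+ ρ) / n - 1ℚ ∣ ℚ.< ε
∣ρ/n-1∣<ε {ε = mkℚ (+ zero) _ _} (*<* (+<+ ()))
∣ρ/n-1∣<ε {ε = mkℚ -[1+ _ ] _ _} (*<* ())
∣ρ/n-1∣<ε {ρ} {n@(suc n-1)} {mkℚ (+ suc p) q-1 _} _ ρ≤n close = ℚ.toℚᵘ-cancel-< (begin-strict
  toℚᵘ ∣ x - 1ℚ ∣                ≃⟨ ℚ.toℚᵘ-homo-∣-∣ (x - 1ℚ) ⟩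
  ℚᵘ.∣ toℚᵘ (x - 1ℚ) ∣           ≃⟨ ℚᵘ.∣-∣-cong (ℚ.toℚᵘ-homo-+ x (ℚ.- 1ℚ)) ⟩
  ℚᵘ.∣ toℚᵘ x ℚᵘ.- 1ℚᵘ ∣         ≃⟨ ℚᵘ.∣-∣-cong (ℚᵘ.+-congˡ (ℚᵘ.- 1ℚᵘ) (ℚ.toℚᵘ-fromℚᵘ (mkℚᵘ (+ ρ) n-1))) ⟩
  ℚᵘ.∣ mkℚᵘ (+ ρ) n-1 ℚᵘ.- 1ℚᵘ ∣ <⟨ ℚᵘ.*<* (subst₂ ℤ._<_ lhs rhs (+<+ cross)) ⟩
  mkℚᵘ (+ suc p) q-1             ∎)
  where
  open ℚᵘ.≤-Reasoning
  x = (+ ρ) / n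
  numerator : ℤ.∣ (+ ρ) ℤ.* + 1 ℤ.+ -[1+ 0 ] ℤ.* + n ∣ ≡ n ∸ ρ
  numerator = trans
    (cong ℤ.∣_∣ (trans (cong₂ ℤ._+_ (ℤ.*-identityʳ (+ ρ)) (ℤ.-1*i≡-i (+ n))) (ℤ.m-n≡m⊖n ρ n)))
    (ℤ.∣⊖∣-≤ ρ≤n)
  lhs : + ((n ∸ ρ) * suc q-1) ≡ + ℤ.∣ (+ ρ) ℤ.* + 1 ℤ.+ -[1+ 0 ] ℤ.* + n ∣ ℤ.* + suc q-1
  lhs = trans (ℤ.pos-* (n ∸ ρ) (suc q-1)) (cong (λ m → + m ℤ.* + suc q-1) (sym numerator))
  rhs : + (suc p * (n * 1)) ≡ + suc p ℤ.* + (n * 1)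
  rhs = ℤ.pos-* (suc p) (n * 1)
  cross : (n ∸ ρ) * suc q-1 < suc p * (n * 1)
  cross = ≤-trans (subst (_< n) (*-comm (suc q-1) (n ∸ ρ)) close)
    (≤-trans (≤-reflexive (sym (*-identityʳ n))) (m≤m+n (n * 1) (p * (n * 1))))

-- 2q (n − ρ) ≤ 2qN + n < 2n, where N bounds the number of small components.
asymmetric⇒close : ∀ q-1 {n} (G : Graph n) → Asymmetric G →
  let q = suc q-1 in 2 * q * length (trees (q-1 + (q + 0))) < n → q * (n ∸ size G) < n
asymmetric⇒close q-1 {n} G asym large = *-cancelˡ-< 2 _ _ (begin-strict
  2 * (q * (n ∸ m))        ≡⟨ *-assoc 2 q (n ∸ m) ⟨
  2 * q * (n ∸ m)          ≡⟨ *-distribˡ-∸ (2 * q) n m ⟩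
  2 * q * n ∸ 2 * q * m    ≤⟨ m≤n+o⇒m∸n≤o (2 * q * n) (2 * q * m) bound ⟩
  2 * q * N + n            <⟨ +-monoˡ-< n large ⟩
  n + n                    ≡⟨ cong (λ m → n + m) (+-identityʳ n) ⟨
  2 * n                    ∎)
  where
  open ≤-Reasoning
  q = suc q-1
  m = size G
  -- This is 2q - 1, written so that `suc k` is `2 * q` by computation.
  k = q-1 + (q + 0)
  N = length (trees k)
  bound : 2 * q * n ≤ 2 * q * m + (2 * q * N + n)
  bound = begin
    2 * q * n                     ≤⟨ asymmetric⇒size G asym k (trees k) (λ C _ → ∈-trees C) ⟩
    2 * q * (m + N) + n           ≡⟨ cong (_+ n) (*-distribˡ-+ (2 * q) m N) ⟩
    2 * q * m + 2 * q * N + n     ≡⟨ +-assoc (2 * q * m) _ n ⟩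
    2 * q * m + (2 * q * N + n)   ∎

-- The cost function and the theorem

ρ′ : ℕ → ℕ
ρ′ n with 6 ℕ.≤? n
... | yes 6≤n = proj₁ (minAsymmetric n 6≤n)
-- A default value: every claim below concerns `n` from 6 on.
... | no _    = 0

ρ′-min : ∀ n → 6 ≤ n → IsMinAsymmetricSize n (ρ′ n)
ρ′-min n 6≤n with 6 ℕ.≤? n
... | yes p = proj₂ (minAsymmetric n p)
... | no ¬p = contradiction 6≤n ¬p

ρ′-upper : ∀ n → 8 ≤ n → ρ′ n ≤ n ∸ 2
ρ′-upper n 8≤n with n ∸ 8 | m+[n∸m]≡n 8≤n
... | k | refl = ≤-trans
  (proj₂ (ρ′-min (8 + k) (m≤m+n 6 (2 + k))) _ (spider (8 + k) , spider-asymmetric , refl))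
  spider-size

theorem3p1 : Σ[ ρ′ ∈ (ℕ → ℕ) ]
    ((n : ℕ) → 6 ≤ n → IsCost (K n) (ρ′ n) × IsMinAsymmetricSize n (ρ′ n))
    × ((n : ℕ) → 8 ≤ n → (n ∸ 2 ∸ ((n ∸ 1) div 7) ≤ ρ′ n) × (ρ′ n ≤ n ∸ 2))
    × ((ε : ℚ) → 0ℚ ℚ.< ε → Σ[ N ∈ ℕ ] ((n : ℕ) .{{_ : NonZero n}} → N ≤ n → ∣ (+ ρ′ n) / n - 1ℚ ∣ ℚ.< ε))
theorem3p1 = ρ′ , cost , bounds , limit
  where
  cost : ∀ n → 6 ≤ n → IsCost (K n) (ρ′ n) × IsMinAsymmetricSize n (ρ′ n)
  cost n 6≤n = minAsymmetric⇒cost (≤-trans (s≤s (s≤s z≤n)) 6≤n) (ρ′-min n 6≤n) , ρ′-min n 6≤n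

  6≤ : ∀ {n} → 8 ≤ n → 6 ≤ n
  6≤ = ≤-trans (m≤m+n 6 2)

  bounds : ∀ n → 8 ≤ n → (n ∸ 2 ∸ ((n ∸ 1) div 7) ≤ ρ′ n) × (ρ′ n ≤ n ∸ 2)
  bounds n 8≤n with (G , asym , eq) , _ ← ρ′-min n (6≤ 8≤n) =
    subst (n ∸ 2 ∸ ((n ∸ 1) div 7) ≤_) eq (asymmetric⇒size-lower G asym) , ρ′-upper n 8≤n

  limit : ∀ ε → 0ℚ ℚ.< ε → Σ[ N ∈ ℕ ] ((n : ℕ) .{{_ : NonZero n}} → N ≤ n → ∣ (+ ρ′ n) / n - 1ℚ ∣ ℚ.< ε)
  -- The 8 puts `n` in the range of the upper bound and makes `N < n` strict.
  limit ε 0<ε = 8 + N , close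
    where
    q-1 = ℚ.denominator-1 ε
    N = 2 * suc q-1 * length (trees (q-1 + (suc q-1 + 0)))
    close : (n : ℕ) .{{_ : NonZero n}} → 8 + N ≤ n → ∣ (+ ρ′ n) / n - 1ℚ ∣ ℚ.< ε
    close n N≤n with 8≤n ← ≤-trans (m≤m+n 8 N) N≤n with (G , asym , eq) , _ ← ρ′-min n (6≤ 8≤n) =
      ∣ρ/n-1∣<ε 0<ε (≤-trans (ρ′-upper n 8≤n) (m∸n≤m n 2))
        (subst (λ m → suc q-1 * (n ∸ m) < n) eq
          (asymmetric⇒close q-1 G asym (≤-trans (s≤s (m≤n+m N 7)) N≤n)))
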